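{- For every integer $s\geq 1$ and every constant $C>0$ there is an $n_0=n_0(s,C)$ with the following property. If $G$ is a $(2s-1)$-leveled graph with $n\geq n_0$ vertices and with $k_{s+1}(G)\leq Cn^s$, then $$|E(G)|\leq \frac{s-1}{2s}n^2+n.$$
   Context: All graphs are finite and simple. $k_r(G)$ denotes the number of cliques with $r$ vertices in $G$. For a clique $\sigma$ in $G$, the link $\mathrm{lk}_G\sigma$ is the subgraph of $G$ induced on the set of vertices adjacent to every vertex of $\sigma$. For an integer $d\geq 0$, a graph $G$ is called $d$-leveled if (i) every maximal clique of $G$ has exactly $d+1$ vertices, and (ii) for every clique $\sigma$ with $d$ vertices, $\mathrm{lk}_G\sigma$ consists of exactly two vertices with no edge between them. (Equivalently, $G$ is the $1$-skeleton of a $d$-dimensional flag weak pseudomanifold.) -}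

module Defs where

open import Data.Nat using (ℕ; zero; suc; _<_)
import Data.Nat as ℕ
open import Data.Bool using (Bool; true; false)
open import Data.Fin using (Fin)
import Data.Fin as F
open import Data.Fin.Subset using (Subset; _∈_; _∉_; ∣_∣)
open import Data.Vec using (Vec; []; _∷_)
open import Data.List using (List; []; _∷_; map; _++_; length; filter; allFin; concatMap)
open import Data.Product using (Σ; ∃; ∃-syntax; _×_; _,_)
open import Data.Sum using (_⊎_)
open import Relation.Nullary using (¬_)
open import Relation.Binary.PropositionalEquality using (_≡_; _≢_)

record Graph (n : ℕ) : Set where
  field
    adj     : Fin n → Fin n → Bool
    symmetric   : ∀ i j → adj i j ≡ adj j i
    irreflexive : ∀ i → adj i i ≡ false

module _ {n : ℕ} (G : Graph n) where
  open Graph G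

  Adj : Fin n → Fin n → Set
  Adj i j = adj i j ≡ true

  IsClique : Subset n → Set
  IsClique σ = ∀ i j → i ∈ σ → j ∈ σ → i ≢ j → Adj i j

  InLink : Subset n → Fin n → Set
  InLink σ v = ∀ i → i ∈ σ → Adj v i

  IsMaximalClique : Subset n → Set
  IsMaximalClique σ = IsClique σ × (∀ v → v ∉ σ → ¬ InLink σ v)

  Leveled : ℕ → Set
  Leveled d =
    (∀ σ → IsMaximalClique σ → ∣ σ ∣ ≡ suc d)
    × (∀ σ → IsClique σ → ∣ σ ∣ ≡ d →
         ∃[ u ] ∃[ v ] (u ≢ v × ¬ Adj u v
            × (∀ w → InLink σ w → (w ≡ u ⊎ w ≡ v))
            × InLink σ u × InLink σ v))

allSubsets : (n : ℕ) → List (Subset n)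
allSubsets zero = [] ∷ []
allSubsets (suc n) = map (true ∷_) (allSubsets n) ++ map (false ∷_) (allSubsets n)

module Counting {n : ℕ} (G : Graph n) where
  open Graph G
  open import Relation.Nullary using (Dec; yes; no)
  open import Relation.Nullary.Decidable using (_×-dec_; ¬?)
  open import Data.Fin.Properties using (all?; _≟_)
  open import Data.Fin.Subset.Properties using (_∈?_)
  open import Data.Bool.Properties using () renaming (_≟_ to _≟ᵇ_)
  open import Relation.Nullary.Decidable using (_→-dec_)

  isClique? : (σ : Subset n) → Dec (IsClique G σ)
  isClique? σ = all? λ i → all? λ j →
    (i ∈? σ) →-dec ((j ∈? σ) →-dec ((¬? (i ≟ j)) →-dec (adj i j ≟ᵇ true)))

k : ℕ → {n : ℕ} → Graph n → ℕ
k r {n} G = length (filter (λ σ → (ℕ._≟_ ∣ σ ∣ r) ×-dec Counting.isClique? G σ) (allSubsets n))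
  where open import Relation.Nullary.Decidable using (_×-dec_)

numEdges : {n : ℕ} → Graph n → ℕ
numEdges {n} G =
  length (filter (λ p → (F._<?_ (Data.Product.proj₁ p) (Data.Product.proj₂ p))
                          ×-dec (Data.Bool.Properties._≟_ (Graph.adj G (Data.Product.proj₁ p) (Data.Product.proj₂ p)) true))
    (concatMap (λ i → map (λ j → (i , j)) (allFin n)) (allFin n)))
  where
    open import Relation.Nullary.Decidable using (_×-dec_)
    import Data.Product
    import Data.Bool.Properties

{-# OPTIONS --safe #-}
-- Assume that 2s|E| > (s-1)n² + 2sn. The Moon–Moser inequalities bound the number of s-cliques below by a multiple of nˢ
-- and show that on average an s-clique x₁,…,xₛ has only boundedly many vertices that miss two of the xᵢ, because there
-- are only O(nˢ) cliques of size s+1. The links of the sets {x₁,…,xₛ} ∖ {xᵢ} thus give an s-colouring of the vertices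
-- with O(n) monochromatic edges; since |E| is large, only O(n) bichromatic pairs are missing, the classes are of
-- linear size, and all but boundedly many vertices are typical, i.e. miss only a small multiple of n such pairs.
--
-- A (2s-1)-clique lies in just two facets, so a generic clique of typical vertices can be enlarged by typical vertices
-- until it meets every colour twice; it is then a facet F. The same construction inside the link of a vertex w would give
-- a clique with 2s+1 vertices, so w has few neighbours in some class; recolour w accordingly. The link of the part of F
-- outside a colour is 2-regular and covers nearly that whole class, so one can choose in all classes but one an edge such
-- that these edges are joined to each other and to any four given typical vertices of the remaining class. The link of
-- the union of these edges is 2-regular, so a typical vertex has at most two typical neighbours of its own colour.
-- An atypical vertex loses more bichromatic pairs than it gains monochromatic edges, and hence the degree sum is at most
-- that of a complete s-partite graph plus 2n.
module Submission where

open import Defs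
open import Data.Nat
open import Data.Nat.Properties
open import Data.Nat.DivMod using (_/_; m/n*n≤m; m≡m%n+[m/n]*n; m%n<n)
open import Data.Nat.ListAction using () renaming (sum to sum′)
import Data.Nat.Tactic.RingSolver as RS
import Algebra.Properties.Semiring.Sum +-*-semiring as ∑
open import Data.Bool using (Bool; true; false)
import Data.Bool.Properties as Bool
open import Data.Empty using (⊥-elim)
open import Data.Fin using (Fin; zero; suc)
import Data.Fin as Fin
import Data.Fin.Properties as Fin
open import Data.Fin.Subset using (Subset; ⊥; ⁅_⁆; ∣_∣) renaming (_∪_ to _∪ˢ_; _∈_ to _∈ˢ_; _∉_ to _∉ˢ_)
open import Data.Fin.Subset.Properties using (x∈⁅x⁆; x∈⁅y⁆⇒x≡y; x∈p∪q⁺; x∈p∪q⁻; ∉⊥; ∪-identityˡ; ∣⊥∣≡0; ∣p∣≤n)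
open import Data.List using (List; []; _∷_; _++_; length; filter; allFin; concatMap)
import Data.List as List
open import Data.List.Properties using (length-++; length-map; length-++-≤ˡ; length-tabulate; ++-identityʳ)
open import Data.List.Membership.Propositional using (_∈_; find; lose)
open import Data.List.Membership.Propositional.Properties using (∈-filter⁺; ∈-filter⁻; ∈-map⁺; ∈-++⁺ˡ; ∈-++⁺ʳ; ∈-concatMap⁺; ∈-allFin)
open import Data.List.Relation.Unary.All using (All; []; _∷_)
import Data.List.Relation.Unary.All as All
import Data.List.Relation.Unary.All.Properties as All
open import Data.List.Relation.Unary.AllPairs using (AllPairs; []; _∷_; allPairs?)
import Data.List.Relation.Unary.AllPairs.Properties as AllPairs
open import Data.List.Relation.Unary.Any using (Any; here; there)
import Data.List.Relation.Unary.Any as Any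
open import Data.List.Relation.Unary.Unique.Propositional.Properties using () renaming (allFin⁺ to allFin-unique)
open import Data.Product using (∃-syntax; _×_; _,_; proj₁; proj₂)
open import Data.Sum using (_⊎_; inj₁; inj₂)
import Data.Sum as Sum
open import Data.Vec using (Vec; []; _∷_; insertAt; removeAt; toList; lookup)
import Data.Vec as Vec
open import Data.Vec.Properties using (removeAt-insertAt; length-toList; lookup⇒[]=; []=⇒lookup)
open import Function using (_∘_; id)
open import Relation.Binary.PropositionalEquality
open import Relation.Nullary using (¬_; Dec; yes; no; does)
open import Relation.Nullary.Decidable using (_×-dec_; _⊎-dec_; ¬?; decidable-stable)
open import Relation.Unary using (Decidable)

private variable
  n r : ℕ
  X Y S : Set
  P Q R : Fin n → Set

-- Finite sums and sums over tuples

-- Opacity keeps the two sum operators rigid, so that the summands can be inferred by unification.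
opaque
  sum : (Fin n → ℕ) → ℕ
  sum = ∑.sum

  tsum : ∀ r → (Vec (Fin n) r → ℕ) → ℕ
  tsum zero    f = f []
  tsum (suc r) f = tsum r λ t → sum λ x → f (x ∷ t)

sum-syntax : ∀ n → (Fin n → ℕ) → ℕ
sum-syntax n = sum

infixl 10 sum-syntax
syntax sum-syntax n (λ i → x) = ∑[ i < n ] x

opaque
  unfolding sum

  sum-cong : {f g : Fin n → ℕ} → (∀ i → f i ≡ g i) → sum f ≡ sum g
  sum-cong = ∑.sum-cong-≗

  sum-+ : (f g : Fin n → ℕ) → ∑[ i < n ] (f i + g i) ≡ sum f + sum g
  sum-+ = ∑.∑-distrib-+

  sum-swap : ∀ {m} (f : Fin m → Fin n → ℕ) → ∑[ i < m ] ∑[ j < n ] f i j ≡ ∑[ j < n ] ∑[ i < m ] f i j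
  sum-swap = ∑.∑-comm

  sum-[] : (f : Fin 0 → ℕ) → sum f ≡ 0
  sum-[] f = refl

  sum-suc : (f : Fin (suc n) → ℕ) → sum f ≡ f zero + sum (f ∘ suc)
  sum-suc f = refl

  sum-mono : {f g : Fin n → ℕ} → (∀ i → f i ≤ g i) → sum f ≤ sum g
  sum-mono {zero}  f≤g = z≤n
  sum-mono {suc n} f≤g = +-mono-≤ (f≤g zero) (sum-mono (f≤g ∘ suc))

  sum-const : ∀ n (c : ℕ) → ∑[ i < n ] c ≡ n * c
  sum-const zero    c = refl
  sum-const (suc n) c = cong (c +_) (sum-const n c)

  sum-zero : ∀ n → ∑[ i < n ] 0 ≡ 0
  sum-zero n = trans (sum-const n 0) (*-zeroʳ n)

  sum-*ˡ : ∀ c (f : Fin n → ℕ) → ∑[ i < n ] (c * f i) ≡ c * sum f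
  sum-*ˡ c f = sym (∑.*-distribˡ-sum c f)

  sum-*ʳ : ∀ c (f : Fin n → ℕ) → ∑[ i < n ] (f i * c) ≡ sum f * c
  sum-*ʳ c f = sym (∑.*-distribʳ-sum c f)

  term≤sum : (f : Fin n → ℕ) → ∀ i → f i ≤ sum f
  term≤sum f zero    = m≤m+n (f zero) _
  term≤sum f (suc i) = ≤-trans (term≤sum (f ∘ suc) i) (m≤n+m _ (f zero))

  sum<⇒∃< : {f g : Fin n → ℕ} → sum f < sum g → ∃[ i ] f i < g i
  sum<⇒∃< {suc n} {f} {g} lt with f zero <? g zero
  ... | yes f₀<g₀ = zero , f₀<g₀
  ... | no  f₀≮g₀ with sum<⇒∃< {f = f ∘ suc} {g ∘ suc}
                         (+-cancelˡ-< (f zero) _ _ (<-≤-trans lt (+-monoˡ-≤ _ (≮⇒≥ f₀≮g₀))))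
  ...   | i , fᵢ<gᵢ = suc i , fᵢ<gᵢ

  0<sum⇒∃ : {f : Fin n → ℕ} → 0 < sum f → ∃[ i ] 0 < f i
  0<sum⇒∃ {n} {f} lt = sum<⇒∃< {f = λ _ → 0} (subst (_< sum f) (sym (sum-zero n)) lt)

opaque
  unfolding tsum

  tsum-[] : (f : Vec (Fin n) 0 → ℕ) → tsum 0 f ≡ f []
  tsum-[] f = refl

  tsum-suc : ∀ r (f : Vec (Fin n) (suc r) → ℕ) → tsum (suc r) f ≡ tsum r λ t → ∑[ x < n ] f (x ∷ t)
  tsum-suc r f = refl

  tsum-cong : ∀ r {f g : Vec (Fin n) r → ℕ} → (∀ t → f t ≡ g t) → tsum r f ≡ tsum r g
  tsum-cong zero    f≗g = f≗g []
  tsum-cong (suc r) f≗g = tsum-cong r λ t → sum-cong λ x → f≗g (x ∷ t)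

  tsum-mono : ∀ r {f g : Vec (Fin n) r → ℕ} → (∀ t → f t ≤ g t) → tsum r f ≤ tsum r g
  tsum-mono zero    f≤g = f≤g []
  tsum-mono (suc r) f≤g = tsum-mono r λ t → sum-mono λ x → f≤g (x ∷ t)

  tsum-+ : ∀ r (f g : Vec (Fin n) r → ℕ) → tsum r (λ t → f t + g t) ≡ tsum r f + tsum r g
  tsum-+ zero    f g = refl
  tsum-+ (suc r) f g = trans (tsum-cong r λ t → sum-+ (λ x → f (x ∷ t)) (λ x → g (x ∷ t))) (tsum-+ r _ _)

  tsum-*ˡ : ∀ r c (f : Vec (Fin n) r → ℕ) → tsum r (λ t → c * f t) ≡ c * tsum r f
  tsum-*ˡ zero    c f = refl
  tsum-*ˡ (suc r) c f = trans (tsum-cong r λ t → sum-*ˡ c (λ x → f (x ∷ t))) (tsum-*ˡ r c _)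

  tsum-*ʳ : ∀ r c (f : Vec (Fin n) r → ℕ) → tsum r (λ t → f t * c) ≡ tsum r f * c
  tsum-*ʳ r c f = trans (tsum-cong r λ t → *-comm (f t) c) (trans (tsum-*ˡ r c f) (*-comm c _))

  tsum-zero : ∀ r → tsum {n} r (λ _ → 0) ≡ 0
  tsum-zero zero    = refl
  tsum-zero {n} (suc r) = trans (tsum-cong r λ _ → sum-zero n) (tsum-zero r)

  tsum-sum : ∀ r {m} (f : Fin m → Vec (Fin n) r → ℕ) →
             tsum r (λ t → ∑[ i < m ] f i t) ≡ ∑[ i < m ] tsum r (f i)
  tsum-sum r {zero}  f = tsum-zero r
  tsum-sum r {suc m} f = trans (tsum-+ r _ _) (cong (tsum r (f zero) +_) (tsum-sum r (f ∘ suc)))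

  tsum<⇒∃< : ∀ r {f g : Vec (Fin n) r → ℕ} → tsum r f < tsum r g → ∃[ t ] f t < g t
  tsum<⇒∃< zero    lt = [] , lt
  tsum<⇒∃< (suc r) lt with tsum<⇒∃< r lt
  ... | t , lt′ with sum<⇒∃< lt′
  ...   | x , lt″ = x ∷ t , lt″

  -- The order of summation is immaterial, so any coordinate can be made the innermost one. This
  -- splits a tuple into its `i`-th entry and the rest.
  tsum-insertAt : ∀ r (i : Fin (suc r)) (f : Vec (Fin n) (suc r) → ℕ) →
                  tsum (suc r) f ≡ tsum r λ t → ∑[ x < n ] f (insertAt t i x)
  tsum-insertAt r       zero    f = refl
  tsum-insertAt (suc r) (suc i) f = trans (tsum-insertAt r i λ t → sum λ x → f (x ∷ t))
    (tsum-cong r λ t → sum-swap λ y x → f (x ∷ insertAt t i y))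

lsum : {X : Set} → (X → ℕ) → List X → ℕ
lsum f xs = sum′ (List.map f xs)

tsum-lsum : ∀ r {X : Set} (f : X → Vec (Fin n) r → ℕ) (xs : List X) →
            tsum r (λ t → lsum (λ x → f x t) xs) ≡ lsum (λ x → tsum r (f x)) xs
tsum-lsum r f []       = tsum-zero r
tsum-lsum r f (x ∷ xs) = trans (tsum-+ r _ _) (cong (tsum r (f x) +_) (tsum-lsum r f xs))

sum-lsum : {X : Set} (f : X → Fin n → ℕ) (xs : List X) →
           ∑[ v < n ] lsum (λ x → f x v) xs ≡ lsum (λ x → sum (f x)) xs
sum-lsum {n} f []       = sum-zero n
sum-lsum f (x ∷ xs) = trans (sum-+ (f x) _) (cong (sum (f x) +_) (sum-lsum f xs))

-- Stands in for subtraction: an estimate is proved with a common summand `C` on both sides, which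
-- two ring identities then expose.
≤-cancel : ∀ {A B L R : ℕ} C → A ≤ B → A ≡ L + C → B ≡ R + C → L ≤ R
≤-cancel {A} {B} {L} {R} C A≤B A≡ B≡ = +-cancelʳ-≤ C L R (subst₂ _≤_ A≡ B≡ A≤B)

-- The Moon–Moser inequality

𝟙 : Bool → ℕ
𝟙 true  = 1
𝟙 false = 0

isZero : ℕ → ℕ
isZero zero    = 1
isZero (suc _) = 0

2*-≤-squares : ∀ x y → 2 * (x * y) ≤ x * x + y * y
2*-≤-squares x y with ≤-total x y
... | inj₁ x≤y = subst (λ z → 2 * (x * z) ≤ x * x + z * z) (m+[n∸m]≡n x≤y) (below x (y ∸ x))
  where
  below : ∀ x d → 2 * (x * (x + d)) ≤ x * x + (x + d) * (x + d)
  below x d = ≤-trans (m≤m+n _ (d * d)) (≤-reflexive (identity x d))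
    where
    identity : ∀ x d → 2 * (x * (x + d)) + d * d ≡ x * x + (x + d) * (x + d)
    identity = RS.solve-∀
... | inj₂ y≤x = subst (λ z → 2 * (z * y) ≤ z * z + y * y) (m+[n∸m]≡n y≤x) (above y (x ∸ y))
  where
  above : ∀ y d → 2 * ((y + d) * y) ≤ (y + d) * (y + d) + y * y
  above y d = ≤-trans (m≤m+n _ (d * d)) (≤-reflexive (identity y d))
    where
    identity : ∀ y d → 2 * ((y + d) * y) + d * d ≡ (y + d) * (y + d) + y * y
    identity = RS.solve-∀

module OrderedCliques {n : ℕ} (G : Graph n) where
  open Graph G

  A : Fin n → Fin n → ℕ
  A u v = 𝟙 (adj u v)

  lk : Vec (Fin n) r → Fin n → ℕ
  lk []      w = 1
  lk (x ∷ P) w = A w x * lk P w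

  cl : Vec (Fin n) r → ℕ
  cl []      = 1
  cl (x ∷ P) = lk P x * cl P

  d : Vec (Fin n) r → ℕ
  d P = sum (lk P)

  -- Each `r`-clique is counted once for each of its r! orderings; tuples with a repeated entry
  -- contribute nothing because adjacency is irreflexive.
  h : ℕ → ℕ
  h r = tsum r cl

  lk-insertAt : (P : Vec (Fin n) r) (i : Fin (suc r)) (x w : Fin n) →
                lk (insertAt P i x) w ≡ A w x * lk P w
  lk-insertAt P       zero    x w = refl
  lk-insertAt (y ∷ P) (suc i) x w = trans (cong (A w y *_) (lk-insertAt P i x w)) (swap (A w y) (A w x) (lk P w))
    where
    swap : ∀ a b c → a * (b * c) ≡ b * (a * c)
    swap = RS.solve-∀

  cl-insertAt : (P : Vec (Fin n) r) (i : Fin (suc r)) (x : Fin n) →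
                cl (insertAt P i x) ≡ lk P x * cl P
  cl-insertAt P       zero    x = refl
  cl-insertAt (y ∷ P) (suc i) x = trans
    (cong₂ _*_ (trans (lk-insertAt P i x y) (cong (λ b → 𝟙 b * lk P y) (symmetric y x))) (cl-insertAt P i x))
    (swap (A x y) (lk P y) (lk P x) (cl P))
    where
    swap : ∀ a b c e → a * b * (c * e) ≡ a * c * (b * e)
    swap = RS.solve-∀

  h-suc : ∀ r → h (suc r) ≡ tsum r λ P → cl P * d P
  h-suc r = trans (tsum-suc r cl) (tsum-cong r λ P → trans (sum-*ʳ (cl P) (lk P)) (*-comm (d P) (cl P)))

  h-1 : h 1 ≡ n
  h-1 = begin
    h 1                      ≡⟨ trans (tsum-suc 0 cl) (tsum-[] _) ⟩
    ∑[ x < n ] 1             ≡⟨ trans (sum-const n 1) (*-identityʳ n) ⟩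
    n ∎
    where open ≡-Reasoning

  -- Double counting of an ordered clique `Q` with a position `i`: removing entry `i` leaves a
  -- clique `P`, and each `P` arises at that position from the `d P` vertices of its link.
  tsum-faces : ∀ r (g : Vec (Fin n) r → ℕ) →
    tsum (suc r) (λ Q → cl Q * ∑[ i < suc r ] g (removeAt Q i)) ≡ suc r * tsum r (λ P → cl P * (d P * g P))
  tsum-faces r g = begin
    tsum (suc r) (λ Q → cl Q * ∑[ i < suc r ] g (removeAt Q i))
      ≡⟨ tsum-cong (suc r) (λ Q → sym (sum-*ˡ (cl Q) _)) ⟩
    tsum (suc r) (λ Q → ∑[ i < suc r ] (cl Q * g (removeAt Q i)))
      ≡⟨ tsum-sum (suc r) (λ i Q → cl Q * g (removeAt Q i)) ⟩
    ∑[ i < suc r ] tsum (suc r) (λ Q → cl Q * g (removeAt Q i))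
      ≡⟨ sum-cong (λ i → trans (tsum-insertAt r i _) (tsum-cong r (face i))) ⟩
    ∑[ i < suc r ] tsum r (λ P → cl P * (d P * g P))
      ≡⟨ sum-const (suc r) _ ⟩
    suc r * tsum r (λ P → cl P * (d P * g P)) ∎
    where
    open ≡-Reasoning
    rearrange : ∀ a b c → a * (b * c) ≡ b * (a * c)
    rearrange = RS.solve-∀
    face : ∀ i P → ∑[ x < n ] (cl (insertAt P i x) * g (removeAt (insertAt P i x) i)) ≡ cl P * (d P * g P)
    face i P = trans
      (sum-cong λ x → trans (cong₂ _*_ (cl-insertAt P i x) (cong g (removeAt-insertAt P i x))) (*-assoc (lk P x) (cl P) (g P)))
      (trans (sum-*ʳ (cl P * g P) (lk P)) (rearrange (d P) (cl P) (g P)))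

  faces : Vec (Fin n) (suc r) → Fin n → ℕ
  faces {r} Q w = ∑[ i < suc r ] lk (removeAt Q i) w

  bit : ∀ b → 𝟙 b ≡ 0 ⊎ 𝟙 b ≡ 1
  bit false = inj₁ refl
  bit true  = inj₂ refl

  faces-[] : ∀ x w → faces (x ∷ []) w ≡ 1
  faces-[] x w = trans (sum-suc _) (cong suc (sum-[] _))

  faces-∷ : ∀ x (P : Vec (Fin n) (suc r)) w → faces (x ∷ P) w ≡ lk P w + A w x * faces P w
  faces-∷ x P@(_ ∷ _) w = trans (sum-suc _) (cong (lk P w +_) (sum-*ˡ (A w x) _))

  -- A vertex joined to all of `Q` lies in the link of every face, one that misses a single entry
  -- only in the link of the face omitting it, and one that misses two or more in none.
  faces-cases : (Q : Vec (Fin n) (suc r)) (w : Fin n) →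
                (lk Q w ≡ 1 × faces Q w ≡ suc r) ⊎ (lk Q w ≡ 0 × faces Q w ≤ 1)
  faces-cases (x ∷ []) w with bit (adj w x)
  ... | inj₁ a = inj₂ (cong (_* 1) a , ≤-reflexive (faces-[] x w))
  ... | inj₂ a = inj₁ (cong (_* 1) a , faces-[] x w)
  faces-cases (x ∷ P@(_ ∷ _)) w with faces-cases P w | bit (adj w x)
  ... | inj₁ (l , f) | inj₁ a = inj₂ (cong₂ _*_ a l , ≤-reflexive (trans (faces-∷ x P w) (cong₂ _+_ l (cong₂ _*_ a f))))
  ... | inj₁ (l , f) | inj₂ a = inj₁ (cong₂ _*_ a l , trans (faces-∷ x P w) (cong₂ _+_ l (trans (cong₂ _*_ a f) (*-identityˡ _))))
  ... | inj₂ (l , f) | inj₁ a = inj₂ (cong₂ _*_ a l , ≤-trans (≤-reflexive (trans (faces-∷ x P w) (cong₂ _+_ l (cong (_* _) a)))) z≤n)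
  ... | inj₂ (l , f) | inj₂ a = inj₂ (cong₂ _*_ a l , ≤-trans (≤-reflexive (trans (faces-∷ x P w) (cong₂ _+_ l (trans (cong (_* _) a) (*-identityˡ _))))) f)

  faces-bound : (Q : Vec (Fin n) (suc r)) (w : Fin n) →
                faces Q w + isZero (faces Q w) ≤ 1 + r * lk Q w
  faces-bound {r} Q w with faces-cases Q w
  ... | inj₁ (l , f) rewrite l | f = ≤-reflexive (trans (+-identityʳ _) (cong suc (sym (*-identityʳ r))))
  ... | inj₂ (l , f) rewrite l = ≤-trans (small f) (m≤m+n 1 _)
    where
    small : ∀ {m} → m ≤ 1 → m + isZero m ≤ 1
    small z≤n       = s≤s z≤n
    small (s≤s z≤n) = s≤s z≤n

  -- The number of vertices that miss at least two members of a clique Q.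
  deficit : Vec (Fin n) (suc r) → ℕ
  deficit Q = ∑[ w < n ] isZero (faces Q w)

  squares : ℕ → ℕ
  squares r = tsum r λ P → cl P * (d P * d P)

  -- Counts triples of an ordered clique `Q`, a face of it and a vertex in the link of that face.
  -- Grouping by the face gives squares of link sizes; grouping by `Q` allows `faces-bound`. The
  -- term with `deficit` is the loss that the classical inequality discards.
  moon-moser : ∀ r → suc r * squares r + tsum (suc r) (λ Q → cl Q * deficit Q) ≤ n * h (suc r) + r * h (2 + r)
  moon-moser r = begin
    suc r * squares r + tsum (suc r) (λ Q → cl Q * deficit Q)
      ≡⟨ cong (_+ tsum (suc r) (λ Q → cl Q * deficit Q)) (sym (tsum-faces r d)) ⟩
    tsum (suc r) (λ Q → cl Q * ∑[ i < suc r ] d (removeAt Q i)) + tsum (suc r) (λ Q → cl Q * deficit Q)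
      ≡⟨ sym (tsum-+ (suc r) _ _) ⟩
    tsum (suc r) (λ Q → cl Q * ∑[ i < suc r ] d (removeAt Q i) + cl Q * deficit Q)
      ≤⟨ tsum-mono (suc r) pointwise ⟩
    tsum (suc r) (λ Q → n * cl Q + r * (cl Q * d Q))
      ≡⟨ tsum-+ (suc r) _ _ ⟩
    tsum (suc r) (λ Q → n * cl Q) + tsum (suc r) (λ Q → r * (cl Q * d Q))
      ≡⟨ cong₂ _+_ (tsum-*ˡ (suc r) n cl) (trans (tsum-*ˡ (suc r) r _) (cong (r *_) (sym (h-suc (suc r))))) ⟩
    n * h (suc r) + r * h (2 + r) ∎
    where
    open ≤-Reasoning
    factor : ∀ c n r d → c * (n * 1 + r * d) ≡ n * c + r * (c * d)
    factor = RS.solve-∀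
    pointwise : ∀ Q → cl Q * ∑[ i < suc r ] d (removeAt Q i) + cl Q * deficit Q ≤ n * cl Q + r * (cl Q * d Q)
    pointwise Q = begin
      cl Q * ∑[ i < suc r ] d (removeAt Q i) + cl Q * deficit Q
        ≡⟨ sym (*-distribˡ-+ (cl Q) _ _) ⟩
      cl Q * (∑[ i < suc r ] d (removeAt Q i) + deficit Q)
        ≡⟨ cong (λ z → cl Q * (z + deficit Q)) (sum-swap λ i w → lk (removeAt Q i) w) ⟩
      cl Q * (sum (faces Q) + deficit Q)
        ≡⟨ cong (cl Q *_) (sym (sum-+ (faces Q) _)) ⟩
      cl Q * ∑[ w < n ] (faces Q w + isZero (faces Q w))
        ≤⟨ *-monoʳ-≤ (cl Q) (sum-mono (faces-bound Q)) ⟩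
      cl Q * ∑[ w < n ] (1 + r * lk Q w)
        ≡⟨ cong (cl Q *_) (trans (sum-+ (λ _ → 1) _) (cong₂ _+_ (sum-const n 1) (sum-*ˡ r (lk Q)))) ⟩
      cl Q * (n * 1 + r * d Q)
        ≡⟨ factor (cl Q) n r (d Q) ⟩
      n * cl Q + r * (cl Q * d Q) ∎

  -- Ratios of consecutive clique counts in a dense graph

  module Chain (s : ℕ) (1≤s : 1 ≤ s) (dense : (s ∸ 1) * n * h 1 ≤ s * h 2) where

    -- Cauchy-Schwarz in tangent form: `2 * (x * y) ≤ x * x + y * y` with `x = s * d P` and `y = c`,
    -- weighted by `cl P` and summed. The hypothesis bounds the `c * c` term by one of the two
    -- copies of `c * (s * h (suc r))`, which cancels.
    squares-bound : ∀ r c → c * h r ≤ s * h (suc r) → c * h (suc r) ≤ s * squares r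
    squares-bound r c ch≤ = *-cancelˡ-≤ s {{>-nonZero 1≤s}} (≤-cancel (c * (s * h (suc r))) combined (split₁ c s (h (suc r))) (split₂ s c (squares r) (h (suc r))))
      where
      open ≤-Reasoning
      split₁ : ∀ c s x → 2 * (c * (s * x)) ≡ s * (c * x) + c * (s * x)
      split₁ = RS.solve-∀
      split₂ : ∀ s c q x → s * s * q + c * (s * x) ≡ s * (s * q) + c * (s * x)
      split₂ = RS.solve-∀
      expand : ∀ k s d c → s * s * (k * (d * d)) + c * c * k ≡ k * (s * d * (s * d) + c * c)
      expand = RS.solve-∀
      expand′ : ∀ k s d c → k * (2 * (s * d * c)) ≡ 2 * (c * (s * 1)) * (k * d)
      expand′ = RS.solve-∀
      regroup : ∀ c s x → 2 * (c * (s * 1)) * x ≡ 2 * (c * (s * x))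
      regroup = RS.solve-∀
      combined : 2 * (c * (s * h (suc r))) ≤ s * s * squares r + c * (s * h (suc r))
      combined = begin
        2 * (c * (s * h (suc r)))
          ≡⟨ trans (cong (λ z → 2 * (c * (s * z))) (h-suc r)) (sym (regroup c s _)) ⟩
        2 * (c * (s * 1)) * tsum r (λ P → cl P * d P)
          ≡⟨ sym (tsum-*ˡ r (2 * (c * (s * 1))) _) ⟩
        tsum r (λ P → 2 * (c * (s * 1)) * (cl P * d P))
          ≡⟨ tsum-cong r (λ P → sym (expand′ (cl P) s (d P) c)) ⟩
        tsum r (λ P → cl P * (2 * (s * d P * c)))
          ≤⟨ tsum-mono r (λ P → *-monoʳ-≤ (cl P) (2*-≤-squares (s * d P) c)) ⟩
        tsum r (λ P → cl P * (s * d P * (s * d P) + c * c))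
          ≡⟨ tsum-cong r (λ P → sym (expand (cl P) s (d P) c)) ⟩
        tsum r (λ P → s * s * (cl P * (d P * d P)) + c * c * cl P)
          ≡⟨ trans (tsum-+ r _ _) (cong₂ _+_ (tsum-*ˡ r (s * s) _) (tsum-*ˡ r (c * c) cl)) ⟩
        s * s * squares r + c * c * h r
          ≡⟨ cong (s * s * squares r +_) (*-assoc c c (h r)) ⟩
        s * s * squares r + c * (c * h r)
          ≤⟨ +-monoʳ-≤ (s * s * squares r) (*-monoʳ-≤ c ch≤) ⟩
        s * s * squares r + c * (s * h (suc r)) ∎

    -- Moon-Moser times `s`, with `squares-bound` inserted for `c = suc t * n`. After cancelling
    -- `s * (n * h (suc r))` the coefficient is `r * t`, because `suc r * suc t = r * t + s`.
    step : ∀ r t → suc r + t ≡ s → suc t * n * h r ≤ s * h (suc r) →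
           r * (t * n * h (suc r)) + s * tsum (suc r) (λ Q → cl Q * deficit Q) ≤ r * (s * h (2 + r))
    step r t refl hyp = ≤-cancel (s * (n * h (suc r))) combined (split₁ r t n (h (suc r)) _) (split₂ s n (h (suc r)) r _)
      where
      open ≤-Reasoning
      split₁ : ∀ r t n x D → suc r * (suc t * n * x) + (suc r + t) * D ≡ r * (t * n * x) + (suc r + t) * D + (suc r + t) * (n * x)
      split₁ = RS.solve-∀
      split₂ : ∀ s n x r y → s * (n * x + r * y) ≡ r * (s * y) + s * (n * x)
      split₂ = RS.solve-∀
      factor : ∀ s r q D → suc r * (s * q) + s * D ≡ s * (suc r * q + D)
      factor = RS.solve-∀
      D = tsum (suc r) (λ Q → cl Q * deficit Q)
      combined : suc r * (suc t * n * h (suc r)) + s * D ≤ s * (n * h (suc r) + r * h (2 + r))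
      combined = begin
        suc r * (suc t * n * h (suc r)) + s * D
          ≤⟨ +-monoˡ-≤ (s * D) (*-monoʳ-≤ (suc r) (squares-bound r (suc t * n) hyp)) ⟩
        suc r * (s * squares r) + s * D
          ≡⟨ factor s r (squares r) D ⟩
        s * (suc r * squares r + D)
          ≤⟨ *-monoʳ-≤ s (moon-moser r) ⟩
        s * (n * h (suc r) + r * h (2 + r)) ∎

    -- The ratio of consecutive clique counts is at least `t * n / s`, as in a balanced complete
    -- `s`-partite graph. The density hypothesis is the case `r = 1`; from there `step`, with its
    -- deficit term dropped, carries the induction.
    chain : ∀ r t → r + t ≡ s → t * n * h r ≤ s * h (suc r)
    chain zero          t refl = ≤-reflexive (begin-equality
      t * n * h 0   ≡⟨ trans (cong (t * n *_) (tsum-[] cl)) (*-identityʳ _) ⟩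
      t * n         ≡⟨ cong (t *_) (sym h-1) ⟩
      t * h 1       ∎)
      where open ≤-Reasoning
    chain (suc zero)    t refl = dense
    chain (suc (suc r)) t eq   = *-cancelˡ-≤ (suc r) (≤-trans (m≤m+n _ _)
      (step (suc r) t eq (chain (suc r) (suc t) (trans (+-suc (suc r) t) eq))))

    -- At `t = 0` the main term on the left of `step` vanishes and only the deficit remains.
    deficit-bound : ∀ r → suc r ≡ s → tsum (suc r) (λ Q → cl Q * deficit Q) ≤ r * h (2 + r)
    deficit-bound r refl = *-cancelˡ-≤ s {{>-nonZero 1≤s}} (≤-trans (m≤n+m _ (r * (0 * n * h (suc r))))
      (≤-trans (step r 0 (+-identityʳ s) (chain r 1 (+-comm r 1))) (≤-reflexive (rearrange r s _))))
      where
      rearrange : ∀ r s y → r * (s * y) ≡ s * (r * y)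
      rearrange = RS.solve-∀

    h-lower : ∀ r t → r + t ≡ s → n ^ r ≤ s ^ r * h r
    h-lower zero    t eq = ≤-reflexive (sym (trans (*-identityˡ _) (tsum-[] cl)))
    h-lower (suc r) t eq = begin
      n * n ^ r                     ≤⟨ *-monoʳ-≤ n (h-lower r (suc t) eq′) ⟩
      n * (s ^ r * h r)             ≡⟨ rearrange n (s ^ r) (h r) ⟩
      s ^ r * (1 * n * h r)         ≤⟨ *-monoʳ-≤ (s ^ r) (*-monoˡ-≤ (h r) (*-monoˡ-≤ n (s≤s (z≤n {t})))) ⟩
      s ^ r * (suc t * n * h r)     ≤⟨ *-monoʳ-≤ (s ^ r) (chain r (suc t) eq′) ⟩
      s ^ r * (s * h (suc r))       ≡⟨ rearrange′ (s ^ r) s (h (suc r)) ⟩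
      s * s ^ r * h (suc r)         ∎
      where
      open ≤-Reasoning
      eq′ = trans (+-suc r t) eq
      rearrange : ∀ n p x → n * (p * x) ≡ p * (1 * n * x)
      rearrange = RS.solve-∀
      rearrange′ : ∀ p s x → p * (s * x) ≡ s * p * x
      rearrange′ = RS.solve-∀

-- A colouring with few monochromatic edges

lsum-++ : (f : X → ℕ) (xs ys : List X) → lsum f (xs ++ ys) ≡ lsum f xs + lsum f ys
lsum-++ f []       ys = refl
lsum-++ f (x ∷ xs) ys = trans (cong (f x +_) (lsum-++ f xs ys)) (sym (+-assoc (f x) _ _))

lsum-map : (f : Y → ℕ) (g : X → Y) (xs : List X) → lsum f (List.map g xs) ≡ lsum (f ∘ g) xs
lsum-map f g []       = refl
lsum-map f g (x ∷ xs) = cong (f (g x) +_) (lsum-map f g xs)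

lsum-concatMap : (f : Y → ℕ) (g : X → List Y) (xs : List X) →
                 lsum f (concatMap g xs) ≡ lsum (λ x → lsum f (g x)) xs
lsum-concatMap f g []       = refl
lsum-concatMap f g (x ∷ xs) = trans (lsum-++ f (g x) _) (cong (lsum f (g x) +_) (lsum-concatMap f g xs))

lsum-tabulate : (f : X → ℕ) (g : Fin n → X) → lsum f (List.tabulate g) ≡ sum (f ∘ g)
lsum-tabulate {n = zero}  f g = sym (sum-[] _)
lsum-tabulate {n = suc n} f g = trans (cong (f (g zero) +_) (lsum-tabulate f (g ∘ suc))) (sym (sum-suc _))

lsum-cong : {f g : X → ℕ} → (∀ x → f x ≡ g x) → (xs : List X) → lsum f xs ≡ lsum g xs
lsum-cong f≗g []       = refl
lsum-cong f≗g (x ∷ xs) = cong₂ _+_ (f≗g x) (lsum-cong f≗g xs)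

lsum-bound : {f : X → ℕ} {c : ℕ} {xs : List X} → All (λ x → f x ≤ c) xs → lsum f xs ≤ length xs * c
lsum-bound []         = z≤n
lsum-bound (le ∷ les) = +-mono-≤ le (lsum-bound les)

∈⇒≤lsum : (f : X → ℕ) {x : X} {xs : List X} → x ∈ xs → f x ≤ lsum f xs
∈⇒≤lsum f (here refl) = m≤m+n _ _
∈⇒≤lsum f (there x∈)  = ≤-trans (∈⇒≤lsum f x∈) (m≤n+m _ _)

length-filter≡lsum : {P : X → Set} (P? : Decidable P) (xs : List X) →
                     length (filter P? xs) ≡ lsum (λ x → 𝟙 (does (P? x))) xs
length-filter≡lsum P? []       = refl
length-filter≡lsum P? (x ∷ xs) with does (P? x)
... | true  = cong suc (length-filter≡lsum P? xs)
... | false = length-filter≡lsum P? xs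

-- Vertex lists as subsets

setOf : List (Fin n) → Subset n
setOf []      = ⊥
setOf (x ∷ l) = ⁅ x ⁆ ∪ˢ setOf l

∈-setOf⁺ : {x : Fin n} {l : List (Fin n)} → x ∈ l → x ∈ˢ setOf l
∈-setOf⁺ (here refl) = x∈p∪q⁺ (inj₁ (x∈⁅x⁆ _))
∈-setOf⁺ (there x∈)  = x∈p∪q⁺ (inj₂ (∈-setOf⁺ x∈))

∈-setOf⁻ : {x : Fin n} (l : List (Fin n)) → x ∈ˢ setOf l → x ∈ l
∈-setOf⁻ []      x∈ = ⊥-elim (∉⊥ x∈)
∈-setOf⁻ (y ∷ l) x∈ with x∈p∪q⁻ ⁅ y ⁆ (setOf l) x∈
... | inj₁ x∈y = here (x∈⁅y⁆⇒x≡y y x∈y)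
... | inj₂ x∈l = there (∈-setOf⁻ l x∈l)

∣⁅x⁆∪p∣ : (x : Fin n) (p : Subset n) → x ∉ˢ p → ∣ ⁅ x ⁆ ∪ˢ p ∣ ≡ suc ∣ p ∣
∣⁅x⁆∪p∣ zero    (true  ∷ p) x∉p = ⊥-elim (x∉p (lookup⇒[]= zero _ refl))
∣⁅x⁆∪p∣ zero    (false ∷ p) x∉p = cong (suc ∘ ∣_∣) (∪-identityˡ p)
∣⁅x⁆∪p∣ (suc x) (true  ∷ p) x∉p = cong suc (∣⁅x⁆∪p∣ x p (x∉p ∘ Vec.there))
∣⁅x⁆∪p∣ (suc x) (false ∷ p) x∉p = ∣⁅x⁆∪p∣ x p (x∉p ∘ Vec.there)

∣setOf∣ : {l : List (Fin n)} → AllPairs _≢_ l → ∣ setOf l ∣ ≡ length l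
∣setOf∣ {n} []       = ∣⊥∣≡0 n
∣setOf∣ {l = x ∷ l} (x≢ ∷ uniq) =
  trans (∣⁅x⁆∪p∣ x (setOf l) λ x∈ → All.lookup x≢ (∈-setOf⁻ l x∈) refl) (cong suc (∣setOf∣ uniq))

∈-allSubsets : (σ : Subset n) → σ ∈ allSubsets n
∈-allSubsets []          = here refl
∈-allSubsets (true  ∷ σ) = ∈-++⁺ˡ (∈-map⁺ (true ∷_) (∈-allSubsets σ))
∈-allSubsets (false ∷ σ) = ∈-++⁺ʳ (List.map (true ∷_) (allSubsets _)) (∈-map⁺ (false ∷_) (∈-allSubsets σ))

∑lookup : (σ : Subset n) → ∑[ x < n ] 𝟙 (lookup σ x) ≡ ∣ σ ∣
∑lookup []          = sum-[] _
∑lookup (true  ∷ σ) = trans (sum-suc _) (cong suc (∑lookup σ))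
∑lookup (false ∷ σ) = trans (sum-suc _) (∑lookup σ)

within : (Fin n → ℕ) → Vec (Fin n) r → ℕ
within f []      = 1
within f (x ∷ t) = f x * within f t

tsum-within : ∀ r (f : Fin n → ℕ) → tsum r (within f) ≡ sum f ^ r
tsum-within zero    f = tsum-[] _
tsum-within (suc r) f = trans (tsum-suc r _) (trans (tsum-cong r λ t → sum-*ʳ (within f t) f)
  (trans (tsum-*ˡ r (sum f) (within f)) (cong (sum f *_) (tsum-within r f))))

within-all : {f : Fin n → ℕ} (t : Vec (Fin n) r) → (∀ {x} → x ∈ toList t → f x ≡ 1) → within f t ≡ 1
within-all []      all = refl
within-all (x ∷ t) all = cong₂ _*_ (all (here refl)) (within-all t (all ∘ there))

𝟙≡1 : ∀ {b} → 𝟙 b ≡ 1 → b ≡ true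
𝟙≡1 {true} eq = refl

𝟙≤1 : ∀ b → 𝟙 b ≤ 1
𝟙≤1 true  = s≤s z≤n
𝟙≤1 false = z≤n

exclusive : {P Q : Set} (P? : Dec P) (Q? : Dec Q) {b : Bool} → (P → ¬ Q) → (P → b ≡ true) → (Q → b ≡ true) →
            𝟙 (does P?) + 𝟙 (does Q?) ≤ 𝟙 b
exclusive (yes p) (yes q) ¬both P⇒b Q⇒b = ⊥-elim (¬both p q)
exclusive (yes p) (no _)  ¬both P⇒b Q⇒b = ≤-reflexive (cong 𝟙 (sym (P⇒b p)))
exclusive (no _)  (yes q) ¬both P⇒b Q⇒b = ≤-reflexive (cong 𝟙 (sym (Q⇒b q)))
exclusive (no _)  (no _)  ¬both P⇒b Q⇒b = z≤n

module Cliques {n : ℕ} (G : Graph n) where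
  open Graph G

  Adj-sym : ∀ {u v} → Adj G u v → Adj G v u
  Adj-sym {u} {v} a = trans (symmetric v u) a

  Adj⇒≢ : ∀ {u v} → Adj G u v → u ≢ v
  Adj⇒≢ {u} a refl with trans (sym a) (irreflexive u)
  ... | ()

  Clique : List (Fin n) → Set
  Clique = AllPairs (Adj G)

  Clique⇒unique : ∀ {l} → Clique l → AllPairs _≢_ l
  Clique⇒unique []       = []
  Clique⇒unique (a ∷ cl) = All.map Adj⇒≢ a ∷ Clique⇒unique cl

  Clique⇒Adj : ∀ {l} → Clique l → ∀ {x y} → x ∈ l → y ∈ l → x ≢ y → Adj G x y
  Clique⇒Adj (a ∷ cl) (here refl) (here refl) x≢y = ⊥-elim (x≢y refl)
  Clique⇒Adj (a ∷ cl) (here refl) (there y∈)  x≢y = All.lookup a y∈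
  Clique⇒Adj (a ∷ cl) (there x∈)  (here refl) x≢y = Adj-sym (All.lookup a x∈)
  Clique⇒Adj (a ∷ cl) (there x∈)  (there y∈)  x≢y = Clique⇒Adj cl x∈ y∈ x≢y

  Clique⇒IsClique : ∀ {l} → Clique l → IsClique G (setOf l)
  Clique⇒IsClique {l} cl i j i∈ j∈ = Clique⇒Adj cl (∈-setOf⁻ l i∈) (∈-setOf⁻ l j∈)

-- Ordered cliques and the counts `k` and `numEdges`

module CliqueCount {n : ℕ} (G : Graph n) where
  open Graph G
  open OrderedCliques G
  open Cliques G

  lk≡1 : (t : Vec (Fin n) r) (w : Fin n) → lk t w ≡ 1 → All (Adj G w) (toList t)
  lk≡1 []      w eq = []
  lk≡1 (x ∷ t) w eq = 𝟙≡1 (m*n≡1⇒m≡1 (A w x) _ eq) ∷ lk≡1 t w (m*n≡1⇒n≡1 (A w x) _ eq)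

  cl≡1 : (t : Vec (Fin n) r) → cl t ≡ 1 → Clique (toList t)
  cl≡1 []      eq = []
  cl≡1 (x ∷ t) eq = lk≡1 t x (m*n≡1⇒m≡1 (lk t x) _ eq) ∷ cl≡1 t (m*n≡1⇒n≡1 (lk t x) _ eq)

  *-bits : ∀ {a b} → a ≡ 0 ⊎ a ≡ 1 → b ≡ 0 ⊎ b ≡ 1 → a * b ≡ 0 ⊎ a * b ≡ 1
  *-bits (inj₁ refl) _        = inj₁ refl
  *-bits (inj₂ refl) (inj₁ refl) = inj₁ refl
  *-bits (inj₂ refl) (inj₂ refl) = inj₂ refl

  lk-bit : (t : Vec (Fin n) r) (w : Fin n) → lk t w ≡ 0 ⊎ lk t w ≡ 1
  lk-bit []      w = inj₂ refl
  lk-bit (x ∷ t) w = *-bits (bit (adj w x)) (lk-bit t w)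

  cl-bit : (t : Vec (Fin n) r) → cl t ≡ 0 ⊎ cl t ≡ 1
  cl-bit []      = inj₂ refl
  cl-bit (x ∷ t) = *-bits (lk-bit t x) (cl-bit t)

  -- Each ordered `r`-clique lies inside the `r`-clique formed by its entries, and an `r`-set
  -- contains `r ^ r` tuples. The crude `r ^ r` in place of r! affects only the constant.
  h≤k : ∀ r → h r ≤ r ^ r * k r G
  h≤k r = begin
    h r                                             ≤⟨ tsum-mono r covered ⟩
    tsum r (λ t → lsum (λ σ → inside σ t) cliques)  ≡⟨ tsum-lsum r inside cliques ⟩
    lsum (λ σ → tsum r (inside σ)) cliques          ≤⟨ lsum-bound (All.tabulate size) ⟩
    k r G * r ^ r                                   ≡⟨ *-comm (k r G) (r ^ r) ⟩
    r ^ r * k r G                                   ∎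
    where
    open ≤-Reasoning
    test : Decidable λ σ → ∣ σ ∣ ≡ r × IsClique G σ
    test σ = (∣ σ ∣ ≟ r) ×-dec Counting.isClique? G σ
    cliques = filter test (allSubsets n)
    inside : Subset n → Vec (Fin n) r → ℕ
    inside σ = within (𝟙 ∘ lookup σ)
    size : ∀ {σ} → σ ∈ cliques → tsum r (inside σ) ≤ r ^ r
    size {σ} σ∈ = ≤-reflexive (trans (tsum-within r _) (cong (_^ r) (trans (∑lookup σ) (proj₁ (proj₂ (∈-filter⁻ test {xs = allSubsets n} σ∈))))))
    covered : ∀ t → cl t ≤ lsum (λ σ → inside σ t) cliques
    covered t with cl-bit t
    ... | inj₁ eq = ≤-trans (≤-reflexive eq) z≤n
    ... | inj₂ eq = ≤-trans (≤-reflexive (trans eq (sym (within-all t λ x∈ → cong 𝟙 ([]=⇒lookup (∈-setOf⁺ x∈))))))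
          (∈⇒≤lsum (λ σ → inside σ t) (∈-filter⁺ test (∈-allSubsets σ)
            (trans (∣setOf∣ (Clique⇒unique cliq)) (length-toList t) , Clique⇒IsClique cliq)))
      where
      cliq = cl≡1 t eq
      σ = setOf (toList t)

  degree : Fin n → ℕ
  degree u = ∑[ v < n ] A u v

  -- `numEdges` lists pairs in increasing order, so an edge and its reversal occupy different
  -- entries of the adjacency matrix.
  2*numEdges≤ : 2 * numEdges G ≤ sum degree
  2*numEdges≤ = begin
    2 * numEdges G
      ≡⟨ cong (2 *_) numEdges≡ ⟩
    2 * ∑[ i < n ] ∑[ j < n ] E i j
      ≡⟨ cong (∑[ i < n ] ∑[ j < n ] E i j +_) (trans (+-identityʳ _) (sum-swap E)) ⟩
    ∑[ i < n ] ∑[ j < n ] E i j + ∑[ i < n ] ∑[ j < n ] E j i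
      ≡⟨ sym (trans (sum-cong λ i → sum-+ _ _) (sum-+ _ _)) ⟩
    ∑[ i < n ] ∑[ j < n ] (E i j + E j i)
      ≤⟨ sum-mono (λ i → sum-mono λ j → oriented i j) ⟩
    sum degree ∎
    where
    open ≤-Reasoning
    edge? : Decidable λ (p : Fin n × Fin n) → proj₁ p Fin.< proj₂ p × adj (proj₁ p) (proj₂ p) ≡ true
    edge? p = (proj₁ p Fin.<? proj₂ p) ×-dec (adj (proj₁ p) (proj₂ p) Bool.≟ true)
    E : Fin n → Fin n → ℕ
    E i j = 𝟙 (does (edge? (i , j)))
    numEdges≡ : numEdges G ≡ ∑[ i < n ] ∑[ j < n ] E i j
    numEdges≡ = trans (length-filter≡lsum edge? (concatMap (λ i → List.map (i ,_) (allFin n)) (allFin n)))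
      (trans (lsum-concatMap _ (λ i → List.map (i ,_) (allFin n)) (allFin n))
      (trans (lsum-cong (λ i → trans (lsum-map _ (i ,_) (allFin n)) (lsum-tabulate _ id)) (allFin n)) (lsum-tabulate _ id)))
    oriented : ∀ i j → E i j + E j i ≤ A i j
    oriented i j = exclusive (edge? (i , j)) (edge? (j , i)) (λ (i<j , _) (j<i , _) → Fin.<-asym i<j j<i)
      proj₂ (λ (_ , a) → trans (symmetric i j) a)

  h-2 : h 2 ≡ sum degree
  h-2 = trans (tsum-suc 1 cl) (trans (tsum-suc 0 _) (trans (tsum-[] _) (trans (sum-swap _)
    (sum-cong λ x → sum-cong λ y → trans (*-identityʳ _) (*-identityʳ _)))))

same : {s : ℕ} → Fin s → Fin s → ℕ
same i j = 𝟙 (does (i Fin.≟ j))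

-- Averaging over the cliques on `s` vertices

module SparseColouring {n : ℕ} (G : Graph n) (m : ℕ) where
  open Graph G
  open OrderedCliques G
  open CliqueCount G
  private
    s = suc m

  monochromatic : (Fin n → Fin s) → ℕ
  monochromatic c = ∑[ u < n ] ∑[ v < n ] (same (c u) (c v) * A u v)

  linkEdges : Vec (Fin n) r → ℕ
  linkEdges P = ∑[ u < n ] ∑[ v < n ] (lk P u * (lk P v * A v u))

  -- Up to a factor 2 this bounds the monochromatic edges of the colouring read off from Q: edges at vertices counted by
  -- deficit, and edges inside the link of a face.
  cost : Vec (Fin n) s → ℕ
  cost Q = n * deficit Q + ∑[ i < s ] linkEdges (removeAt Q i)

  -- An ordered clique on `2 + m` vertices is a clique of `m` vertices together with an ordered edge
  -- of its link.
  h-2+ : h (2 + m) ≡ tsum m λ P → cl P * linkEdges P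
  h-2+ = trans (tsum-suc (suc m) cl) (trans (tsum-suc m _) (tsum-cong m λ P →
    trans (sum-cong λ u → trans (sum-cong λ v → regroup (A v u) (lk P v) (lk P u) (cl P)) (sum-*ˡ (cl P) _)) (sum-*ˡ (cl P) _)))
    where
    regroup : ∀ a x y c → a * x * (y * c) ≡ c * (y * (x * a))
    regroup = RS.solve-∀

  d≤n : (P : Vec (Fin n) r) → d P ≤ n
  d≤n P = ≤-trans (sum-mono λ w → lk≤1 w) (≤-reflexive (trans (sum-const n 1) (*-identityʳ n)))
    where
    lk≤1 : ∀ w → lk P w ≤ 1
    lk≤1 w with lk-bit P w
    ... | inj₁ eq = ≤-trans (≤-reflexive eq) z≤n
    ... | inj₂ eq = ≤-reflexive eq

  -- The hypothesis handles the deficit part. In the link part `tsum-faces` produces a factor `d P`,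
  -- at most `n`, and the remaining sum is `h (2 + m)`.
  total-cost : tsum s (λ Q → cl Q * deficit Q) ≤ m * h (2 + m) →
               tsum s (λ Q → cl Q * cost Q) ≤ 2 * s * n * h (2 + m)
  total-cost def≤ = begin
    tsum s (λ Q → cl Q * cost Q)
      ≡⟨ tsum-cong s (λ Q → distribute (cl Q) n (deficit Q) _) ⟩
    tsum s (λ Q → n * (cl Q * deficit Q) + cl Q * ∑[ i < s ] linkEdges (removeAt Q i))
      ≡⟨ tsum-+ s _ _ ⟩
    tsum s (λ Q → n * (cl Q * deficit Q)) + tsum s (λ Q → cl Q * ∑[ i < s ] linkEdges (removeAt Q i))
      ≡⟨ cong₂ _+_ (tsum-*ˡ s n _) (tsum-faces m linkEdges) ⟩
    n * tsum s (λ Q → cl Q * deficit Q) + s * tsum m (λ P → cl P * (d P * linkEdges P))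
      ≤⟨ +-mono-≤ (*-monoʳ-≤ n (≤-trans def≤ (*-monoˡ-≤ (h (2 + m)) (n≤1+n m))))
           (*-monoʳ-≤ s (tsum-mono m λ P → ≤-trans (*-monoʳ-≤ (cl P) (*-monoˡ-≤ (linkEdges P) (d≤n P)))
             (≤-reflexive (swap (cl P) n (linkEdges P))))) ⟩
    n * (s * h (2 + m)) + s * tsum m (λ P → n * (cl P * linkEdges P))
      ≡⟨ cong (λ z → n * (s * h (2 + m)) + s * z) (trans (tsum-*ˡ m n _) (cong (n *_) (sym h-2+))) ⟩
    n * (s * h (2 + m)) + s * (n * h (2 + m))
      ≡⟨ collect n s (h (2 + m)) ⟩
    2 * s * n * h (2 + m) ∎
    where
    open ≤-Reasoning
    distribute : ∀ c n d e → c * (n * d + e) ≡ n * (c * d) + c * e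
    distribute = RS.solve-∀
    swap : ∀ a b c → a * (b * c) ≡ b * (a * c)
    swap = RS.solve-∀
    collect : ∀ n s x → n * (s * x) + s * (n * x) ≡ 2 * s * n * x
    collect = RS.solve-∀

  colour : Vec (Fin n) s → Fin n → Fin s
  colour Q w with Fin.any? (λ i → lk (removeAt Q i) w ≟ 1)
  ... | yes (i , _) = i
  -- Default for a vertex in no face link; its edges are charged to `deficit`, whatever its colour.
  ... | no  _       = zero

  colour-spec : ∀ Q w → isZero (faces Q w) ≡ 1 ⊎ lk (removeAt Q (colour Q w)) w ≡ 1
  colour-spec Q w with Fin.any? (λ i → lk (removeAt Q i) w ≟ 1)
  ... | yes (i , eq) = inj₂ eq
  ... | no  none     = inj₁ (cong isZero (trans (sum-cong zeros) (sum-zero s)))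
    where
    zeros : ∀ i → lk (removeAt Q i) w ≡ 0
    zeros i with lk-bit (removeAt Q i) w
    ... | inj₁ eq = eq
    ... | inj₂ eq = ⊥-elim (none (i , eq))

  -- A monochromatic edge either has an end in no face link, and is charged to `deficit`, or has
  -- both ends in the link of the face given by their common colour. Charging at either end causes
  -- the factor 2.
  monochromatic≤cost : ∀ Q → monochromatic (colour Q) ≤ 2 * cost Q
  monochromatic≤cost Q = begin
    monochromatic (colour Q)
      ≤⟨ sum-mono (λ u → sum-mono λ v → pointwise u v) ⟩
    ∑[ u < n ] ∑[ v < n ] (z u + z v + ∑[ i < s ] (L i u * (L i v * A v u)))
      ≡⟨ trans (sum-cong λ u → trans (sum-+ _ _) (cong₂ _+_ (trans (sum-+ _ _) (cong (_+ deficit Q) (sum-const n (z u)))) (sum-swap _)))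
           (trans (sum-+ _ _) (cong₂ _+_ (trans (sum-+ _ _) (cong₂ _+_ (sum-*ˡ n z) (sum-const n (deficit Q)))) (sum-swap _))) ⟩
    n * deficit Q + n * deficit Q + ∑[ i < s ] linkEdges (removeAt Q i)
      ≤⟨ ≤-trans (m≤m+n _ (∑[ i < s ] linkEdges (removeAt Q i))) (≤-reflexive (double (n * deficit Q) _)) ⟩
    2 * cost Q ∎
    where
    open ≤-Reasoning
    z = λ w → isZero (faces Q w)
    L = λ i → lk (removeAt Q i)
    double : ∀ x y → x + x + y + y ≡ 2 * (x + y)
    double = RS.solve-∀
    at-most-1 : ∀ i j u v → same {s} i j * A u v ≤ 1
    at-most-1 i j u v = *-mono-≤ (𝟙≤1 (does (i Fin.≟ j))) (𝟙≤1 (adj u v))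
    pointwise : ∀ u v → same (colour Q u) (colour Q v) * A u v ≤ z u + z v + ∑[ i < s ] (L i u * (L i v * A v u))
    pointwise u v with colour-spec Q u | colour-spec Q v
    ... | inj₁ eq | _       = ≤-trans (at-most-1 (colour Q u) (colour Q v) u v) (≤-trans (≤-reflexive (sym eq)) (≤-trans (m≤m+n (z u) (z v)) (m≤m+n _ _)))
    ... | inj₂ _  | inj₁ eq = ≤-trans (at-most-1 (colour Q u) (colour Q v) u v) (≤-trans (≤-reflexive (sym eq)) (≤-trans (m≤n+m (z v) (z u)) (m≤m+n _ _)))
    ... | inj₂ lu | inj₂ lv with colour Q u Fin.≟ colour Q v
    ...   | no  _   = z≤n
    ...   | yes cuv = ≤-trans (≤-reflexive (sym same-link)) (≤-trans (term≤sum (λ i → L i u * (L i v * A v u)) (colour Q u)) (m≤n+m _ (z u + z v)))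
      where
      same-link : L (colour Q u) u * (L (colour Q u) v * A v u) ≡ 1 * A u v
      same-link = cong₂ _*_ lu (trans (cong₂ _*_ (trans (cong (λ i → L i v) cuv) lv) (cong 𝟙 (symmetric v u))) (*-identityˡ _))

  sparse-colouring : ∀ p q → 1 ≤ q → 1 ≤ n → m * n * n ≤ s * sum degree → q * k (suc s) G ≤ p * n ^ s →
    ∃[ c ] monochromatic c ≤ 2 * (2 * s * suc s ^ suc s * p * s ^ s) * n
  sparse-colouring p q 1≤q 1≤n dense few = colour Q₀ , (begin
    monochromatic (colour Q₀)  ≤⟨ monochromatic≤cost Q₀ ⟩
    2 * cost Q₀               ≤⟨ *-monoʳ-≤ 2 (≤-trans (m≤m*n (cost Q₀) q {{>-nonZero 1≤q}}) (s≤s⁻¹ (*-cancelˡ-< (cl Q₀) _ _ cheap))) ⟩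
    2 * (K * n)               ≡⟨ sym (*-assoc 2 K n) ⟩
    2 * K * n                 ∎)
    where
    open ≤-Reasoning
    open Chain s (s≤s z≤n) (≤-trans (≤-reflexive (cong (m * n *_) h-1)) (≤-trans dense (≤-reflexive (cong (s *_) (sym h-2)))))
    -- In `K` the factor `W` is the loss in `h≤k`, and `s ^ s` is the loss in `h-lower`.
    W = suc s ^ suc s
    K = 2 * s * W * p * s ^ s
    reassoc : ∀ s n W q k → 2 * s * n * (W * k) * q ≡ 2 * s * n * W * (q * k)
    reassoc = RS.solve-∀
    reassoc′ : ∀ s n W p P H → 2 * s * n * W * (p * (P * H)) ≡ H * (2 * s * W * p * P * n)
    reassoc′ = RS.solve-∀
    lower : n ^ s ≤ s ^ s * h s
    lower = h-lower s 0 (+-identityʳ s)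
    h>0 : 0 < h s
    h>0 = n≢0⇒n>0 λ h≡0 → <⇒≱ (m^n>0 n {{>-nonZero 1≤n}} s) (≤-trans lower (≤-reflexive (trans (cong (s ^ s *_) h≡0) (*-zeroʳ (s ^ s)))))
    -- The successor makes the inequality strict because `h s` is positive. Some clique is then
    -- below average, and cancelling `cl Q₀` still leaves `cost Q₀ * q ≤ K * n`.
    average : tsum s (λ Q → cl Q * (cost Q * q)) < tsum s (λ Q → cl Q * suc (K * n))
    average = begin-strict
      tsum s (λ Q → cl Q * (cost Q * q))      ≡⟨ trans (tsum-cong s λ Q → sym (*-assoc (cl Q) (cost Q) q)) (tsum-*ʳ s q _) ⟩
      tsum s (λ Q → cl Q * cost Q) * q        ≤⟨ *-monoˡ-≤ q (total-cost (deficit-bound m refl)) ⟩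
      2 * s * n * h (2 + m) * q               ≤⟨ *-monoˡ-≤ q (*-monoʳ-≤ (2 * s * n) (h≤k (2 + m))) ⟩
      2 * s * n * (W * k (suc s) G) * q       ≡⟨ reassoc s n W q (k (suc s) G) ⟩
      2 * s * n * W * (q * k (suc s) G)       ≤⟨ *-monoʳ-≤ (2 * s * n * W) (≤-trans few (*-monoʳ-≤ p lower)) ⟩
      2 * s * n * W * (p * (s ^ s * h s))     ≡⟨ reassoc′ s n W p (s ^ s) (h s) ⟩
      h s * (K * n)                           <⟨ *-monoʳ-< (h s) {{>-nonZero h>0}} (n<1+n (K * n)) ⟩
      h s * suc (K * n)                       ≡⟨ sym (tsum-*ʳ s (suc (K * n)) cl) ⟩
      tsum s (λ Q → cl Q * suc (K * n))       ∎
    Q₀ : Vec (Fin n) s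
    Q₀ = proj₁ (tsum<⇒∃< s average)
    cheap : cl Q₀ * (cost Q₀ * q) < cl Q₀ * suc (K * n)
    cheap = proj₂ (tsum<⇒∃< s average)

-- Counting by decidable predicates

opaque
  ⟦_⟧ : Dec S → ℕ
  ⟦ S? ⟧ = 𝟙 (does S?)

  ⟦⟧≡𝟙 : (S? : Dec S) → ⟦ S? ⟧ ≡ 𝟙 (does S?)
  ⟦⟧≡𝟙 S? = refl

  ⟦⟧-yes : (S? : Dec S) → S → ⟦ S? ⟧ ≡ 1
  ⟦⟧-yes (yes _) s = refl
  ⟦⟧-yes (no ¬s) s = ⊥-elim (¬s s)

  ⟦⟧-no : (S? : Dec S) → ¬ S → ⟦ S? ⟧ ≡ 0
  ⟦⟧-no (yes s) ¬s = ⊥-elim (¬s s)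
  ⟦⟧-no (no _)  ¬s = refl

  ⟦⟧-true : (S? : Dec S) → 0 < ⟦ S? ⟧ → S
  ⟦⟧-true (yes s) _ = s

  ⟦⟧≤ : (S? : Dec S) {m : ℕ} → (S → 1 ≤ m) → ⟦ S? ⟧ ≤ m
  ⟦⟧≤ (yes s) bound = bound s
  ⟦⟧≤ (no _)  bound = z≤n

  ⟦⟧*≤ : (S? : Dec S) {k m : ℕ} → (S → k ≤ m) → ⟦ S? ⟧ * k ≤ m
  ⟦⟧*≤ (yes s) {k} bound = ≤-trans (≤-reflexive (*-identityˡ k)) (bound s)
  ⟦⟧*≤ (no _)  bound = z≤n

  1≤⟦⟧ : (S? : Dec S) → S → 1 ≤ ⟦ S? ⟧
  1≤⟦⟧ S? s = ≤-reflexive (sym (⟦⟧-yes S? s))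

∑-point : (i : Fin n) (f : Fin n → ℕ) → ∑[ j < n ] (⟦ i Fin.≟ j ⟧ * f j) ≡ f i
∑-point {suc n} zero f = trans (sum-suc _) (trans (cong₂ _+_
  (trans (cong (_* f zero) (⟦⟧-yes (Fin.zero {n} Fin.≟ zero) refl)) (*-identityˡ (f zero)))
  (trans (sum-cong λ j → cong (_* f (suc j)) (⟦⟧-no (zero Fin.≟ suc j) λ ())) (sum-zero n))) (+-identityʳ _))
∑-point (suc i) f = trans (sum-suc _) (trans (cong₂ _+_ (cong (_* f zero) (⟦⟧-no (suc i Fin.≟ zero) λ ())) (sum-cong λ j → cong (_* f (suc j)) (shift i j))) (∑-point i (f ∘ suc)))
  where
  shift : ∀ i j → ⟦ suc i Fin.≟ suc j ⟧ ≡ ⟦ i Fin.≟ j ⟧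
  shift i j = ≤-antisym (⟦⟧≤ (suc i Fin.≟ suc j) λ eq → 1≤⟦⟧ (i Fin.≟ j) (Fin.suc-injective eq))
                        (⟦⟧≤ (i Fin.≟ j) λ eq → 1≤⟦⟧ (suc i Fin.≟ suc j) (cong suc eq))

∑-point-1 : (i : Fin n) → ∑[ j < n ] ⟦ i Fin.≟ j ⟧ ≡ 1
∑-point-1 i = trans (sum-cong λ j → sym (*-identityʳ _)) (∑-point i (λ _ → 1))

opaque
  count : Decidable P → ℕ
  count {n} P? = ∑[ v < n ] ⟦ P? v ⟧

  count≡∑ : (P? : Decidable P) → count P? ≡ sum λ v → ⟦ P? v ⟧
  count≡∑ P? = refl

  count-mono : (P? : Decidable P) (Q? : Decidable Q) → (∀ {v} → P v → Q v) → count P? ≤ count Q?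
  count-mono P? Q? P⊆Q = sum-mono λ v → ⟦⟧≤ (P? v) λ p → 1≤⟦⟧ (Q? v) (P⊆Q p)

  count-cover : {P Q R : Fin n → Set} (P? : Decidable P) (Q? : Decidable Q) (R? : Decidable R) →
                (∀ {v} → P v → Q v ⊎ R v) → count P? ≤ count Q? + count R?
  count-cover {Q = Q} {R} P? Q? R? cover = ≤-trans (sum-mono λ v → ⟦⟧≤ (P? v) λ p → lower v (cover p)) (≤-reflexive (sum-+ _ _))
    where
    lower : ∀ v → Q v ⊎ R v → 1 ≤ ⟦ Q? v ⟧ + ⟦ R? v ⟧
    lower v (inj₁ q) = ≤-trans (1≤⟦⟧ (Q? v) q) (m≤m+n _ _)
    lower v (inj₂ r) = ≤-trans (1≤⟦⟧ (R? v) r) (m≤n+m _ _)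

  count-Any : {B : X → Fin n → Set} (B? : ∀ x → Decidable (B x)) {c : ℕ} {xs : List X} →
              All (λ x → count (B? x) ≤ c) xs → count (λ v → Any.any? (λ x → B? x v) xs) ≤ length xs * c
  count-Any {n = n} {B = B} B? {xs = xs} bounds = begin
    count (λ v → Any.any? (λ x → B? x v) xs)   ≤⟨ sum-mono (λ v → ⟦⟧≤ (Any.any? (λ x → B? x v) xs) (detect v)) ⟩
    ∑[ v < n ] lsum (λ x → ⟦ B? x v ⟧) xs      ≡⟨ sum-lsum (λ x v → ⟦ B? x v ⟧) xs ⟩
    lsum (λ x → count (B? x)) xs               ≤⟨ lsum-bound bounds ⟩
    length xs * _                              ∎
    where
    open ≤-Reasoning
    detect : ∀ v {ys} → Any (λ x → B x v) ys → 1 ≤ lsum (λ x → ⟦ B? x v ⟧) ys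
    detect v (here {y} b)  = ≤-trans (1≤⟦⟧ (B? y v) b) (m≤m+n _ _)
    detect v (there {y} b) = ≤-trans (detect v b) (m≤n+m _ ⟦ B? y v ⟧)

  count-conditional : {P : Fin n → Set} (S? : Dec S) (P? : Decidable P) {c : ℕ} → (S → count P? ≤ c) → count (λ v → S? ×-dec P? v) ≤ c
  count-conditional (yes s) P? bound = ≤-trans (count-mono (λ v → yes s ×-dec P? v) P? proj₂) (bound s)
  count-conditional {n = n} (no ¬s) P? bound = ≤-trans (sum-mono λ v → ⟦⟧≤ (no ¬s ×-dec P? v) λ (s , _) → ⊥-elim (¬s s))
    (≤-trans (≤-reflexive (sum-zero n)) z≤n)

  count-pick : (Bad? : Decidable Q) (P? : Decidable P) → count Bad? < count P? → ∃[ v ] P v × ¬ Q v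
  count-pick Bad? P? lt with sum<⇒∃< lt
  ... | v , lt′ = v , ⟦⟧-true (P? v) (≤-<-trans z≤n lt′) , λ bad → <⇒≱ lt′ (≤-trans (⟦⟧≤ (P? v) λ _ → s≤s z≤n) (1≤⟦⟧ (Bad? v) bad))

  count-remove : (P? : Decidable P) {x : Fin n} → P x → count P? ≡ suc (count λ v → P? v ×-dec ¬? (x Fin.≟ v))
  count-remove {n} P? {x} px = begin
    count P?
      ≡⟨ sum-cong split ⟩
    ∑[ v < n ] (⟦ x Fin.≟ v ⟧ + ⟦ P? v ×-dec ¬? (x Fin.≟ v) ⟧)
      ≡⟨ trans (sum-+ _ _) (cong (_+ count (λ v → P? v ×-dec ¬? (x Fin.≟ v))) (∑-point-1 x)) ⟩
    suc (count λ v → P? v ×-dec ¬? (x Fin.≟ v)) ∎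
    where
    open ≡-Reasoning
    split : ∀ v → ⟦ P? v ⟧ ≡ ⟦ x Fin.≟ v ⟧ + ⟦ P? v ×-dec ¬? (x Fin.≟ v) ⟧
    split v with x Fin.≟ v
    ... | yes refl = trans (⟦⟧-yes (P? v) px) (sym (cong₂ _+_ (⟦⟧-yes (yes refl) refl) (⟦⟧-no (P? v ×-dec no _) λ (_ , x≢x) → x≢x refl)))
    ... | no  x≢v  = trans (≤-antisym (⟦⟧≤ (P? v) λ p → 1≤⟦⟧ (P? v ×-dec yes x≢v) (p , x≢v)) (⟦⟧≤ (P? v ×-dec yes x≢v) λ (p , _) → 1≤⟦⟧ (P? v) p))
      (cong (_+ ⟦ P? v ×-dec yes x≢v ⟧) (sym (⟦⟧-no (no x≢v) x≢v)))

unique-length≤count : (P? : Decidable P) {l : List (Fin n)} → AllPairs _≢_ l → All P l → length l ≤ count P?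
unique-length≤count P? []           []         = z≤n
unique-length≤count P? (x≢ ∷ uniq) (px ∷ pxs) = ≤-trans
  (s≤s (unique-length≤count (λ v → P? v ×-dec ¬? (_ Fin.≟ v)) uniq (All.zip (pxs , x≢))))
  (≤-reflexive (sym (count-remove P? px)))

extract : ∀ m (P? : Decidable P) → m ≤ count P? → ∃[ l ] AllPairs _≢_ l × length l ≡ m × All P l
extract zero    P? _  = [] , [] , refl , []
extract (suc m) P? le with 0<sum⇒∃ (<-≤-trans z<s (≤-trans le (≤-reflexive (count≡∑ P?))))
... | x , pos with extract m (λ v → P? v ×-dec ¬? (x Fin.≟ v)) (s≤s⁻¹ (≤-trans le (≤-reflexive (count-remove P? px))))
  where px = ⟦⟧-true (P? x) pos
...   | l , uniq , len , all = x ∷ l , All.map proj₂ all ∷ uniq , cong suc len , ⟦⟧-true (P? x) pos ∷ All.map proj₁ all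

length-filter-allFin : {P : Fin n → Set} (P? : Decidable P) → length (filter P? (allFin n)) ≡ count P?
length-filter-allFin {n} P? = trans (length-filter≡lsum P? (allFin n)) (trans (lsum-tabulate _ id)
  (trans (sum-cong λ v → sym (⟦⟧≡𝟙 (P? v))) (sym (count≡∑ P?))))

length-filter-split : {P : X → Set} (P? : Decidable P) (xs : List X) →
                      length (filter P? xs) + length (filter (¬? ∘ P?) xs) ≡ length xs
length-filter-split P? []       = refl
length-filter-split P? (x ∷ xs) with P? x
... | yes _ = cong suc (length-filter-split P? xs)
... | no  _ = trans (+-suc _ _) (cong suc (length-filter-split P? xs))

AllPairs-++⁻ : {R : X → X → Set} (xs : List X) {ys : List X} → AllPairs R (xs ++ ys) →
               AllPairs R xs × AllPairs R ys × All (λ x → All (R x) ys) xs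
AllPairs-++⁻ []       rs       = [] , rs , []
AllPairs-++⁻ (x ∷ xs) (r ∷ rs) with AllPairs-++⁻ xs rs | All.++⁻ xs r
... | rxs , rys , rxys | rx , ry = rx ∷ rxs , rys , ry ∷ rxys

AllPairs-filter-++ : {R : X → X → Set} {P : X → Set} (P? : Decidable P) (xs : List X) {ys : List X} →
                     AllPairs R (xs ++ ys) → AllPairs R (filter P? xs ++ ys)
AllPairs-filter-++ P? xs rs with AllPairs-++⁻ xs rs
... | rxs , rys , rxys = AllPairs.++⁺ (AllPairs.filter⁺ P? rxs) rys (All.filter⁺ P? rxys)

-- Applied to the atypical vertices: every clique of `r` of them is one of boundedly many words.
words : List X → ℕ → List (List X)
words B zero    = [] ∷ []
words B (suc r) = concatMap (λ x → List.map (x ∷_) (words B r)) B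

length-words : (B : List X) (r : ℕ) → length (words B r) ≡ length B ^ r
length-words B zero    = refl
length-words B (suc r) = go B
  where
  go : ∀ C → length (concatMap (λ x → List.map (x ∷_) (words B r)) C) ≡ length C * length B ^ r
  go []      = refl
  go (x ∷ C) = trans (length-++ (List.map (x ∷_) (words B r)))
    (cong₂ _+_ (trans (length-map (x ∷_) (words B r)) (length-words B r)) (go C))

∈-words : {B t : List X} → All (_∈ B) t → t ∈ words B (length t)
∈-words []         = here refl
∈-words {B = B} {t = x ∷ t} (x∈ ∷ all) =
  ∈-concatMap⁺ (λ y → List.map (y ∷_) (words B (length t))) (Any.map (λ {refl → ∈-map⁺ (x ∷_) (∈-words all)}) x∈)

-- Cliques in leveled graphs

module LeveledCliques {n : ℕ} (G : Graph n) (d : ℕ) (leveled : Leveled G d) where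
  open Graph G
  open Cliques G public

  adj? : ∀ u v → Dec (Adj G u v)
  adj? u v = adj u v Bool.≟ true

  Linked : List (Fin n) → Fin n → Set
  Linked l v = All (Adj G v) l

  linked? : ∀ l → Decidable (Linked l)
  linked? l v = All.all? (adj? v) l

  length≤n : ∀ {l} → Clique l → length l ≤ n
  length≤n {l} cl = ≤-trans (≤-reflexive (sym (∣setOf∣ (Clique⇒unique cl)))) (∣p∣≤n (setOf l))

  InLink⇒Linked : ∀ {l v} → InLink G (setOf l) v → Linked l v
  InLink⇒Linked inlink = All.tabulate λ x∈ → inlink _ (∈-setOf⁺ x∈)

  Linked⇒InLink : ∀ {l v} → Linked l v → InLink G (setOf l) v
  Linked⇒InLink {l} linked i i∈ = All.lookup linked (∈-setOf⁻ l i∈)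

  opaque
    -- Adding common neighbours until none is left gives a maximal clique, whose size is fixed by
    -- condition (i). A clique has at most `n` vertices, so `suc n` rounds of fuel suffice.
    extend : ∀ {l} → Clique l → ∃[ π ] Clique (π ++ l) × length (π ++ l) ≡ suc d
    extend {l} cl = go (suc n) l cl (s≤s (m≤m+n n _))
      where
      go : ∀ fuel l → Clique l → n < fuel + length l → ∃[ π ] Clique (π ++ l) × length (π ++ l) ≡ suc d
      go zero       l cl lt = ⊥-elim (<⇒≱ lt (length≤n cl))
      go (suc fuel) l cl lt with Fin.any? (linked? l)
      ... | no maximal = [] , cl , trans (sym (∣setOf∣ (Clique⇒unique cl)))
            (proj₁ leveled (setOf l) (Clique⇒IsClique cl , λ v _ link → maximal (v , InLink⇒Linked link)))
      ... | yes (v , link) with go fuel (v ∷ l) (link ∷ cl) (≤-trans lt (≤-reflexive (sym (+-suc fuel _))))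
      ...   | π , cl′ , len = π ++ v ∷ [] , subst (λ m → Clique m × length m ≡ suc d) (assoc π) (cl′ , len)
        where
        assoc : ∀ π → π ++ v ∷ l ≡ (π ++ v ∷ []) ++ l
        assoc []      = refl
        assoc (x ∷ π) = cong (x ∷_) (assoc π)

  length≤ : ∀ {l} → Clique l → length l ≤ suc d
  length≤ {l} cl with extend cl
  ... | π , _ , len = ≤-trans (m≤n+m _ (length π)) (≤-reflexive (trans (sym (length-++ π)) len))

  -- Condition (ii) enters the proof only through this count.
  count-linked : ∀ {l} → Clique l → length l ≡ d → count (linked? l) ≡ 2
  count-linked {l} cl len with proj₂ leveled (setOf l) (Clique⇒IsClique cl) (trans (∣setOf∣ (Clique⇒unique cl)) len)
  ... | u , v , u≢v , _ , only , lu , lv = begin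
    count (linked? l)
      ≡⟨ trans (count≡∑ (linked? l)) (sum-cong split) ⟩
    ∑[ w < n ] (⟦ u Fin.≟ w ⟧ + ⟦ v Fin.≟ w ⟧)
      ≡⟨ trans (sum-+ _ _) (cong₂ _+_ (∑-point-1 u) (∑-point-1 v)) ⟩
    2 ∎
    where
    open ≡-Reasoning
    split : ∀ w → ⟦ linked? l w ⟧ ≡ ⟦ u Fin.≟ w ⟧ + ⟦ v Fin.≟ w ⟧
    split w with u Fin.≟ w | v Fin.≟ w
    ... | yes refl | yes refl = ⊥-elim (u≢v refl)
    ... | yes refl | no  v≢w  = trans (⟦⟧-yes (linked? l w) (InLink⇒Linked lu)) (sym (cong₂ _+_ (⟦⟧-yes (yes refl) refl) (⟦⟧-no (no v≢w) v≢w)))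
    ... | no  u≢w  | yes refl = trans (⟦⟧-yes (linked? l w) (InLink⇒Linked lv)) (sym (cong₂ _+_ (⟦⟧-no (no u≢w) u≢w) (⟦⟧-yes (yes refl) refl)))
    ... | no  u≢w  | no  v≢w  = trans (⟦⟧-no (linked? l w) λ link → Sum.[ (λ eq → u≢w (sym eq)) , (λ eq → v≢w (sym eq)) ] (only w (Linked⇒InLink link)))
                                      (sym (cong₂ _+_ (⟦⟧-no (no u≢w) u≢w) (⟦⟧-no (no v≢w) v≢w)))

module Colouring {n s : ℕ} (G : Graph n) (c : Fin n → Fin s) where
  open Graph G

  Missing : Fin n → Fin n → Set
  Missing v u = c u ≢ c v × ¬ Adj G v u

  missing? : ∀ v → Decidable (Missing v)
  missing? v u = ¬? (c u Fin.≟ c v) ×-dec ¬? (adj v u Bool.≟ true)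

  miss : Fin n → ℕ
  miss v = count (missing? v)

  coloured? : ∀ j → Decidable (λ u → c u ≡ j)
  coloured? j u = c u Fin.≟ j

  size : Fin s → ℕ
  size j = count (coloured? j)

  neighbour? : ∀ j v → Decidable (λ u → c u ≡ j × Adj G v u)
  neighbour? j v u = (c u Fin.≟ j) ×-dec (adj v u Bool.≟ true)

  degreeTo : Fin s → Fin n → ℕ
  degreeTo j v = count (neighbour? j v)

  occurrences : Fin s → List (Fin n) → ℕ
  occurrences j l = length (filter (coloured? j) l)

  others : Fin s → List (Fin n) → List (Fin n)
  others j = filter (¬? ∘ coloured? j)

  ∑-occurrences : ∀ l → ∑[ j < s ] occurrences j l ≡ length l
  ∑-occurrences []      = sum-zero s
  ∑-occurrences (x ∷ l) = trans (sum-cong step) (trans (sum-+ _ _) (cong₂ _+_ (∑-point-1 (c x)) (∑-occurrences l)))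
    where
    step : ∀ j → occurrences j (x ∷ l) ≡ ⟦ c x Fin.≟ j ⟧ + occurrences j l
    step j with c x Fin.≟ j
    ... | yes eq = cong (_+ occurrences j l) (sym (⟦⟧-yes (yes eq) eq))
    ... | no  ≢j = cong (_+ occurrences j l) (sym (⟦⟧-no (no ≢j) ≢j))

-- Saturating cliques with typical vertices

module Saturate {n s : ℕ} (G : Graph n) (d : ℕ) (d≡ : suc d ≡ s * 2) (leveled : Leveled G d)
                (c : Fin n → Fin s) (μ b : ℕ) where
  open Graph G
  open LeveledCliques G d leveled
  open Colouring G c

  Typical : Fin n → Set
  Typical v = miss v ≤ μ

  typical? : Decidable Typical
  typical? v = miss v ≤? μ

  -- The summands allow for vertices missing one of at most `suc d` typical vertices, for atypical
  -- vertices, and for blocked ones. The base is `suc b` so that powers increase with the exponent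
  -- even when `b` is 0.
  bound : ℕ
  bound = suc d * μ + (b + 2 * suc b ^ suc d)

  module _ (few : count (¬? ∘ typical?) ≤ b) where

    atypical : List (Fin n)
    atypical = filter (¬? ∘ typical?) (allFin n)

    -- The conditions on `t ++ β` are part of the predicate so that at most two `v` satisfy it,
    -- whatever the word `t`.
    Blocking : List (Fin n) → List (Fin n) → Fin n → Set
    Blocking β t v = (Clique (t ++ β) × length (t ++ β) ≡ d) × Linked (t ++ β) v

    blocking? : ∀ β t → Decidable (Blocking β t)
    blocking? β t v = (allPairs? adj? (t ++ β) ×-dec (length (t ++ β) ≟ d)) ×-dec linked? (t ++ β) v

    few-blocked : ∀ β t → count (blocking? β t) ≤ 2
    few-blocked β t = count-conditional (allPairs? adj? (t ++ β) ×-dec (length (t ++ β) ≟ d)) (linked? (t ++ β))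
      λ (cl , len) → ≤-reflexive (count-linked cl len)

    blocked? : ∀ β ℓ → Decidable (λ v → Any (λ t → Blocking β t v) (words atypical ℓ))
    blocked? β ℓ v = Any.any? (λ t → blocking? β t v) (words atypical ℓ)

    count-blocked : ∀ β ℓ → ℓ ≤ suc d → count (blocked? β ℓ) ≤ 2 * suc b ^ suc d
    count-blocked β ℓ ℓ≤ = begin
      count (blocked? β ℓ)           ≤⟨ count-Any (blocking? β) (All.universal (few-blocked β) (words atypical ℓ)) ⟩
      length (words atypical ℓ) * 2  ≡⟨ *-comm (length (words atypical ℓ)) 2 ⟩
      2 * length (words atypical ℓ)  ≡⟨ cong (2 *_) (trans (length-words atypical ℓ) (cong (_^ ℓ) (length-filter-allFin (¬? ∘ typical?)))) ⟩
      2 * count (¬? ∘ typical?) ^ ℓ  ≤⟨ *-monoʳ-≤ 2 (^-monoˡ-≤ ℓ (≤-trans few (n≤1+n b))) ⟩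
      2 * suc b ^ ℓ                  ≤⟨ *-monoʳ-≤ 2 (^-monoʳ-≤ (suc b) ℓ≤) ⟩
      2 * suc b ^ suc d              ∎
      where open ≤-Reasoning

    missed? : ∀ ρ → Decidable (λ v → Any (λ y → Missing y v) ρ)
    missed? ρ v = Any.any? (λ y → missing? y v) ρ

    Bad : List (Fin n) → List (Fin n) → Fin n → Set
    Bad ρ β v = Any (λ y → Missing y v) ρ ⊎ (¬ Typical v ⊎ Any (λ t → Blocking β t v) (words atypical (d ∸ length β)))

    bad? : ∀ ρ β → Decidable (Bad ρ β)
    bad? ρ β v = missed? ρ v ⊎-dec (¬? (typical? v) ⊎-dec blocked? β (d ∸ length β) v)

    few-bad : ∀ ρ β → All Typical ρ → length ρ ≤ suc d → count (bad? ρ β) ≤ bound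
    few-bad ρ β typ short = begin
      count (bad? ρ β)
        ≤⟨ count-cover (bad? ρ β) (missed? ρ) atypical-or-blocked? id ⟩
      count (missed? ρ) + count atypical-or-blocked?
        ≤⟨ +-monoʳ-≤ (count (missed? ρ)) (count-cover atypical-or-blocked? (¬? ∘ typical?) (blocked? β (d ∸ length β)) id) ⟩
      count (missed? ρ) + (count (¬? ∘ typical?) + count (blocked? β (d ∸ length β)))
        ≤⟨ +-mono-≤ (≤-trans (count-Any missing? typ) (*-monoˡ-≤ μ short))
             (+-mono-≤ few (count-blocked β (d ∸ length β) (≤-trans (m∸n≤m d (length β)) (n≤1+n d)))) ⟩
      suc d * μ + (b + 2 * suc b ^ suc d) ∎
      where
      open ≤-Reasoning
      atypical-or-blocked? : Decidable λ v → ¬ Typical v ⊎ Any (λ t → Blocking β t v) (words atypical (d ∸ length β))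
      atypical-or-blocked? v = ¬? (typical? v) ⊎-dec blocked? β (d ∸ length β) v

    occurs : ∀ β t → All (¬_ ∘ Typical) t → length (t ++ β) ≡ d → t ∈ words atypical (d ∸ length β)
    occurs β t none len = subst (λ m → t ∈ words atypical m)
      (sym (trans (cong (_∸ length β) (trans (sym len) (length-++ t))) (m+n∸n≡m (length t) (length β))))
      (∈-words (All.map (∈-filter⁺ (¬? ∘ typical?) (∈-allFin _)) none))

    Avoids : List (Fin n) → Fin n → Set
    Avoids β q = ∀ t → All (¬_ ∘ Typical) t → Clique (t ++ β) → length (t ++ β) ≡ d → ¬ Linked (t ++ β) q

    generic : ∀ ρ β {P : Fin n → Set} (P? : Decidable P) → All Typical ρ → length ρ ≤ suc d → bound < count P? →
              ∃[ q ] P q × All (λ y → ¬ Missing y q) ρ × Typical q × Avoids β q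
    generic ρ β {P} P? typ short large = conclude (count-pick (bad? ρ β) P? (≤-<-trans (few-bad ρ β typ short) large))
      where
      conclude : ∃[ q ] P q × ¬ Bad ρ β q → ∃[ q ] P q × All (λ y → ¬ Missing y q) ρ × Typical q × Avoids β q
      conclude (q , pq , good) = q , pq , All.¬Any⇒All¬ ρ (good ∘ inj₁) , decidable-stable (typical? q) (good ∘ inj₂ ∘ inj₁) ,
        λ t none cl len link → good (inj₂ (inj₂ (lose (occurs β t none len) ((cl , len) , link))))

  module _ (few : count (¬? ∘ typical?) ≤ b) (τ : List (Fin n))
           (rich : ∀ j → bound < count (λ v → coloured? j v ×-dec linked? τ v)) where

    Growth : List (Fin n) → Set
    Growth σ = ∃[ σ′ ] All Typical σ′ × Clique (σ′ ++ τ) × length σ < length σ′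

    -- Replacing the vertices of a colour that occurs at most once by a suitably generic vertex q forces a facet
    -- through q to contain a further typical vertex: if all its new vertices were atypical, q would lie in one
    -- of the boundedly many two-element links of (d-1)-faces spanned by the remaining vertices and atypical ones.
    grow : ∀ σ j → All Typical σ → Clique (σ ++ τ) → occurrences j σ ≤ 1 → Growth σ
    grow σ j typ cl once = through (generic few ρ (ρ ++ τ) (λ v → coloured? j v ×-dec linked? τ v) typρ
                                      (≤-trans (length-++-≤ˡ ρ) (length≤ clρτ)) (rich j))
      where
      ρ : List (Fin n)
      ρ = others j σ
      typρ : All Typical ρ
      typρ = All.filter⁺ (¬? ∘ coloured? j) typ
      clρτ : Clique (ρ ++ τ)
      clρτ = AllPairs-filter-++ (¬? ∘ coloured? j) σ cl
      longer : length σ ≤ suc (length ρ)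
      longer = ≤-trans (≤-reflexive (sym (length-filter-split (coloured? j) σ))) (+-monoˡ-≤ (length ρ) once)
      through : (∃[ q ] (c q ≡ j × Linked τ q) × All (λ y → ¬ Missing y q) ρ × Typical q × Avoids few (ρ ++ τ) q) →
                Growth σ
      through (q , (cq , qτ) , present , typq , avoids) = result (extend (qρτ ∷ clρτ))
        where
        qρ : Linked ρ q
        qρ = All.tabulate λ {y} y∈ → Adj-sym (decidable-stable (adj? y q) λ ¬a → All.lookup present y∈
               ((λ eq → proj₂ (∈-filter⁻ (¬? ∘ coloured? j) {xs = σ} y∈) (trans (sym eq) cq)) , ¬a))
        qρτ : Linked (ρ ++ τ) q
        qρτ = All.++⁺ qρ qτ
        enlarge : ∀ π → length (π ++ q ∷ ρ ++ τ) ≡ suc d → Clique π × Clique (q ∷ ρ ++ τ) × All (Linked (q ∷ ρ ++ τ)) π →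
                  Dec (Any Typical π) → Growth σ
        -- At most one vertex of `σ` was given up, and both `q` and `t` are gained.
        enlarge π len (_ , _ , cross) (yes any) = let (t , t∈ , typt) = find any in
          t ∷ q ∷ ρ , typt ∷ typq ∷ typρ , All.lookup cross t∈ ∷ qρτ ∷ clρτ , s≤s longer
        enlarge π len (clπ , _ , cross) (no none) = ⊥-elim (avoids π (All.¬Any⇒All¬ π none)
          (AllPairs.++⁺ clπ clρτ (All.map All.tail cross))
          (suc-injective (trans (cong suc (length-++ π)) (trans (sym (+-suc (length π) _)) (trans (sym (length-++ π)) len))))
          (All.++⁺ (All.map (Adj-sym ∘ All.head) cross) qρτ))
        result : ∃[ π ] Clique (π ++ q ∷ ρ ++ τ) × length (π ++ q ∷ ρ ++ τ) ≡ suc d → Growth σ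
        result (π , clπ , len) = enlarge π len (AllPairs-++⁻ π clπ) (Any.any? typical? π)

    -- Iterates `grow`. Every round lengthens the clique, and no clique has more than `suc d`
    -- vertices, so fuel `2 + d` cannot run out.
    saturated : Clique τ → ∃[ σ ] All Typical σ × Clique (σ ++ τ) × (∀ j → 2 ≤ occurrences j σ)
    saturated clτ = go (2 + d) [] [] clτ (≤-reflexive (sym (+-identityʳ _)))
      where
      Saturation : Set
      Saturation = ∃[ σ ] All Typical σ × Clique (σ ++ τ) × (∀ j → 2 ≤ occurrences j σ)
      go : ∀ fuel σ → All Typical σ → Clique (σ ++ τ) → suc d < fuel + length σ → Saturation
      continue : ∀ fuel σ → suc d < suc fuel + length σ → Growth σ → Saturation
      continue fuel σ lt (σ′ , typ′ , cl′ , longer) = go fuel σ′ typ′ cl′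
        (<-≤-trans lt (≤-trans (≤-reflexive (sym (+-suc fuel _))) (+-monoʳ-≤ fuel longer)))
      go zero       σ typ cl lt = ⊥-elim (<⇒≱ lt (≤-trans (length-++-≤ˡ σ) (length≤ cl)))
      go (suc fuel) σ typ cl lt with Fin.any? (λ j → occurrences j σ ≤? 1)
      ... | no  none       = σ , typ , cl , λ j → ≰⇒> λ once → none (j , once)
      ... | yes (j , once) = continue fuel σ lt (grow σ j typ cl once)

    long : ∀ σ → (∀ j → 2 ≤ occurrences j σ) → s * 2 ≤ length σ
    long σ twice = ≤-trans (≤-reflexive (sym (sum-const s 2))) (≤-trans (sum-mono twice) (≤-reflexive (∑-occurrences σ)))

-- Sums over colour classes

-- By rows the relation `R` has at least `count P? * k` pairs, by columns at most `count Q? * k`,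
-- since columns outside `Q` are empty.
double-count : {P : Fin n → Set} {Q : Fin n → Set} {R : Fin n → Fin n → Set} (P? : Decidable P) (Q? : Decidable Q)
               (R? : ∀ u → Decidable (R u)) (k : ℕ) → (∀ u → P u → k ≤ count (R? u)) →
               (∀ v → Q v → count (λ u → R? u v) ≤ k) → (∀ u v → R u v → Q v) → count P? * k ≤ count Q? * k
double-count {n} {Q = Q} {R} P? Q? R? k low high R⊆Q = begin
  count P? * k                          ≡⟨ trans (cong (_* k) (count≡∑ P?)) (sym (sum-*ʳ k _)) ⟩
  ∑[ u < n ] (⟦ P? u ⟧ * k)             ≤⟨ sum-mono (λ u → ⟦⟧*≤ (P? u) λ p → ≤-trans (low u p) (≤-reflexive (count≡∑ (R? u)))) ⟩
  ∑[ u < n ] ∑[ v < n ] ⟦ R? u v ⟧      ≡⟨ sum-swap (λ u v → ⟦ R? u v ⟧) ⟩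
  ∑[ v < n ] ∑[ u < n ] ⟦ R? u v ⟧      ≤⟨ sum-mono (λ v → column v (Q? v)) ⟩
  ∑[ v < n ] (⟦ Q? v ⟧ * k)             ≡⟨ trans (sum-*ʳ k _) (cong (_* k) (sym (count≡∑ Q?))) ⟩
  count Q? * k                          ∎
  where
  open ≤-Reasoning
  column : ∀ v (q? : Dec (Q v)) → ∑[ u < n ] ⟦ R? u v ⟧ ≤ ⟦ q? ⟧ * k
  column v (yes q) = ≤-trans (≤-reflexive (sym (count≡∑ (λ u → R? u v)))) (≤-trans (high v q)
    (≤-reflexive (sym (trans (cong (_* k) (⟦⟧-yes (yes q) q)) (*-identityˡ k)))))
  column v (no ¬q) = ≤-trans (sum-mono λ u → ⟦⟧≤ (R? u v) λ r → ⊥-elim (¬q (R⊆Q u v r))) (≤-trans (≤-reflexive (sum-zero n)) z≤n)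

module ColourSums {n s : ℕ} (G : Graph n) (c : Fin n → Fin s) where
  open Graph G
  open Colouring G c
  open CliqueCount G using (degree)

  inner : Fin n → ℕ
  inner v = degreeTo (c v) v

  -- A vertex `u` of another colour is either adjacent to `v` or missing. One of the same colour is
  -- counted by `size` and, if adjacent, once more on each side.
  balance-at : ∀ v → degree v + miss v + size (c v) ≡ n + inner v
  balance-at v = begin
    degree v + miss v + size (c v)
      ≡⟨ cong₂ (λ x y → degree v + x + y) (count≡∑ (missing? v)) (count≡∑ (coloured? (c v))) ⟩
    degree v + ∑[ u < n ] ⟦ missing? v u ⟧ + ∑[ u < n ] ⟦ coloured? (c v) u ⟧
      ≡⟨ sym (trans (sum-+ _ _) (cong (_+ ∑[ u < n ] ⟦ coloured? (c v) u ⟧) (sum-+ _ _))) ⟩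
    ∑[ u < n ] (𝟙 (adj v u) + ⟦ missing? v u ⟧ + ⟦ coloured? (c v) u ⟧)
      ≡⟨ sum-cong (λ u → cases u (adj v u) refl (c u Fin.≟ c v)) ⟩
    ∑[ u < n ] (1 + ⟦ neighbour? (c v) v u ⟧)
      ≡⟨ trans (sum-+ _ _) (cong₂ _+_ (trans (sum-const n 1) (*-identityʳ n)) (sym (count≡∑ (neighbour? (c v) v)))) ⟩
    n + inner v ∎
    where
    open ≡-Reasoning
    cases : ∀ u b → adj v u ≡ b → Dec (c u ≡ c v) →
            𝟙 (adj v u) + ⟦ missing? v u ⟧ + ⟦ coloured? (c v) u ⟧ ≡ 1 + ⟦ neighbour? (c v) v u ⟧
    cases u true  eq (yes cu) = trans (cong₂ _+_ (cong₂ _+_ (cong 𝟙 eq) (⟦⟧-no (missing? v u) λ (≢ , _) → ≢ cu)) (⟦⟧-yes (coloured? (c v) u) cu))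
      (cong suc (sym (⟦⟧-yes (neighbour? (c v) v u) (cu , eq))))
    cases u true  eq (no ¬cu) = trans (cong₂ _+_ (cong₂ _+_ (cong 𝟙 eq) (⟦⟧-no (missing? v u) λ (_ , ¬a) → ¬a eq)) (⟦⟧-no (coloured? (c v) u) ¬cu))
      (cong suc (sym (⟦⟧-no (neighbour? (c v) v u) λ (cu , _) → ¬cu cu)))
    cases u false eq (yes cu) = trans (cong₂ _+_ (cong₂ _+_ (cong 𝟙 eq) (⟦⟧-no (missing? v u) λ (≢ , _) → ≢ cu)) (⟦⟧-yes (coloured? (c v) u) cu))
      (cong suc (sym (⟦⟧-no (neighbour? (c v) v u) λ (_ , a) → Bool.not-¬ eq a)))
    cases u false eq (no ¬cu) = trans (cong₂ _+_ (cong₂ _+_ (cong 𝟙 eq) (⟦⟧-yes (missing? v u) (¬cu , Bool.not-¬ eq))) (⟦⟧-no (coloured? (c v) u) ¬cu))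
      (cong suc (sym (⟦⟧-no (neighbour? (c v) v u) λ (cu , _) → ¬cu cu)))

  balance : sum degree + sum miss + ∑[ v < n ] size (c v) ≡ n * n + sum inner
  balance = trans (sym (trans (sum-+ _ _) (cong (_+ ∑[ v < n ] size (c v)) (sum-+ _ _))))
    (trans (sum-cong balance-at) (trans (sum-+ _ _) (cong (_+ sum inner) (sum-const n n))))

  ∑-size : sum size ≡ n
  ∑-size = begin
    sum size                                     ≡⟨ sum-cong (λ j → count≡∑ (coloured? j)) ⟩
    ∑[ j < s ] ∑[ u < n ] ⟦ coloured? j u ⟧      ≡⟨ sum-swap (λ j u → ⟦ coloured? j u ⟧) ⟩
    ∑[ u < n ] ∑[ j < s ] ⟦ c u Fin.≟ j ⟧        ≡⟨ sum-cong (λ u → ∑-point-1 (c u)) ⟩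
    ∑[ u < n ] 1                                 ≡⟨ trans (sum-const n 1) (*-identityʳ n) ⟩
    n                                            ∎
    where open ≡-Reasoning

  ∑-size-colour : ∑[ v < n ] size (c v) ≡ ∑[ j < s ] (size j * size j)
  ∑-size-colour = begin
    ∑[ v < n ] size (c v)                                ≡⟨ sum-cong (λ v → sym (∑-point (c v) size)) ⟩
    ∑[ v < n ] ∑[ j < s ] (⟦ coloured? j v ⟧ * size j)   ≡⟨ sum-swap (λ v j → ⟦ coloured? j v ⟧ * size j) ⟩
    ∑[ j < s ] ∑[ v < n ] (⟦ coloured? j v ⟧ * size j)   ≡⟨ sum-cong (λ j → trans (sum-*ʳ (size j) _) (cong (_* size j) (sym (count≡∑ (coloured? j))))) ⟩
    ∑[ j < s ] (size j * size j)                         ∎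
    where open ≡-Reasoning

  -- A quadratic expression in the class sizes is bounded termwise by a linear one, and their sum is known.
  ∑-size-linear : ∀ a e (f : Fin s → ℕ) → (∀ j → 2 * (s * size j * n) * a + f j ≤ (s * size j * (s * size j) + n * n) * a) →
                  e ≤ sum f → s * (n * n) * a + e ≤ s * (s * ∑[ v < n ] size (c v)) * a
  ∑-size-linear a e f termwise e≤ = ≤-cancel (s * (n * n) * a) summed (regroup s n a e) (regroup′ s S₂ (n * n) a)
    where
    open ≤-Reasoning
    S₂ = ∑[ v < n ] size (c v)
    regroup : ∀ s n a e → 2 * (s * n * n) * a + e ≡ s * (n * n) * a + e + s * (n * n) * a
    regroup = RS.solve-∀
    regroup′ : ∀ s S m a → (s * s * S + s * m) * a ≡ s * (s * S) * a + s * m * a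
    regroup′ = RS.solve-∀
    linear : ∀ s x n a → 2 * (s * x * n) * a ≡ x * (2 * (s * n) * a)
    linear = RS.solve-∀
    linear′ : ∀ s n a → n * (2 * (s * n) * a) ≡ 2 * (s * n * n) * a
    linear′ = RS.solve-∀
    square : ∀ s x → s * x * (s * x) ≡ s * s * (x * x)
    square = RS.solve-∀
    summed : 2 * (s * n * n) * a + e ≤ (s * s * S₂ + s * (n * n)) * a
    summed = begin
      2 * (s * n * n) * a + e
        ≡⟨ cong (_+ e) (sym (trans (sum-cong λ j → linear s (size j) n a) (trans (sum-*ʳ (2 * (s * n) * a) size) (trans (cong (_* (2 * (s * n) * a)) ∑-size) (linear′ s n a))))) ⟩
      ∑[ j < s ] (2 * (s * size j * n) * a) + e
        ≤⟨ +-monoʳ-≤ (∑[ j < s ] (2 * (s * size j * n) * a)) e≤ ⟩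
      ∑[ j < s ] (2 * (s * size j * n) * a) + sum f
        ≡⟨ sym (sum-+ _ _) ⟩
      ∑[ j < s ] (2 * (s * size j * n) * a + f j)
        ≤⟨ sum-mono termwise ⟩
      ∑[ j < s ] ((s * size j * (s * size j) + n * n) * a)
        ≡⟨ sum-*ʳ a _ ⟩
      ∑[ j < s ] (s * size j * (s * size j) + n * n) * a
        ≡⟨ cong (_* a) (trans (sum-+ _ _) (cong₂ _+_ (trans (sum-cong λ j → square s (size j)) (trans (sum-*ˡ (s * s) _) (cong (s * s *_) (sym ∑-size-colour)))) (sum-const s (n * n)))) ⟩
      (s * s * S₂ + s * (n * n)) * a ∎

  -- Cauchy-Schwarz for the class sizes: `∑-size-linear` with zero slack.
  size-square-lower : 1 ≤ s → n * n ≤ s * ∑[ v < n ] size (c v)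
  size-square-lower 1≤s = *-cancelˡ-≤ s {{>-nonZero 1≤s}} (≤-trans (≤-reflexive (sym (trans (+-identityʳ _) (*-identityʳ _))))
    (≤-trans (∑-size-linear 1 0 (λ _ → 0) (λ j → ≤-trans (≤-reflexive (trans (+-identityʳ _) (*-identityʳ _)))
      (≤-trans (2*-≤-squares (s * size j) n) (≤-reflexive (sym (*-identityʳ _))))) z≤n) (≤-reflexive (*-identityʳ _))))

  -- If `2 * s * size j₀ ≤ n`, the square of `n - s * size j₀` is at least a quarter of `n * n`.
  -- This surplus of the single class `j₀` exceeds what the upper bound on the sum of squares
  -- allows; the factor 4 clears the denominator.
  size-lower : ∀ e → s * ∑[ v < n ] size (c v) ≤ n * n + e → 4 * s * e < n * n → ∀ j → n < 2 * s * size j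
  size-lower e upper gap j₀ = ≰⇒> λ small → <⇒≱ gap (squeeze small)
    where
    open ≤-Reasoning
    S₂ = ∑[ v < n ] size (c v)
    slack : 2 * s * size j₀ ≤ n → ∀ j → 2 * (s * size j * n) * 4 + ⟦ j₀ Fin.≟ j ⟧ * (n * n) ≤ (s * size j * (s * size j) + n * n) * 4
    slack small j with j₀ Fin.≟ j
    ... | no ≢ = ≤-trans (≤-reflexive (trans (cong (λ z → 2 * (s * size j * n) * 4 + z * (n * n)) (⟦⟧-no (no ≢) ≢)) (+-identityʳ _)))
          (*-monoˡ-≤ 4 (2*-≤-squares (s * size j) n))
    ... | yes refl = ≤-trans (≤-reflexive (cong (λ z → 2 * (s * size j * n) * 4 + z * (n * n)) (⟦⟧-yes (yes refl) refl)))
          (subst (λ z → 2 * (s * size j * z) * 4 + 1 * (z * z) ≤ (s * size j * (s * size j) + z * z) * 4) (m+[n∸m]≡n small) (shifted s (size j) (n ∸ 2 * s * size j)))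
      where
      -- With y = 2sx and n = y + t this is (n - y)(3n - y) ≥ 0.
      shifted : ∀ s x t → 2 * (s * x * (2 * s * x + t)) * 4 + 1 * ((2 * s * x + t) * (2 * s * x + t)) ≤
                          (s * x * (s * x) + (2 * s * x + t) * (2 * s * x + t)) * 4
      shifted s x t = ≤-trans (m≤m+n _ (t * (2 * (2 * s * x) + 3 * t))) (≤-reflexive (identity s x t))
        where
        identity : ∀ s x t → 2 * (s * x * (2 * s * x + t)) * 4 + 1 * ((2 * s * x + t) * (2 * s * x + t)) + t * (2 * (2 * s * x) + 3 * t) ≡
                             (s * x * (s * x) + (2 * s * x + t) * (2 * s * x + t)) * 4
        identity = RS.solve-∀
    squeeze : 2 * s * size j₀ ≤ n → n * n ≤ 4 * s * e
    squeeze small = ≤-cancel (s * (n * n) * 4) (begin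
      s * (n * n) * 4 + n * n
        ≤⟨ ∑-size-linear 4 (n * n) _ (slack small) (≤-reflexive (sym (∑-point j₀ (λ _ → n * n)))) ⟩
      s * (s * S₂) * 4
        ≤⟨ *-monoˡ-≤ 4 (*-monoʳ-≤ s upper) ⟩
      s * (n * n + e) * 4 ∎) (+-comm (s * (n * n) * 4) (n * n)) (expand s (n * n) e)
      where
      expand : ∀ s m e → s * (m + e) * 4 ≡ 4 * s * e + s * m * 4
      expand = RS.solve-∀

-- Linear bound on the monochromatic degrees

module Endgame {n s : ℕ} (G : Graph n) (d : ℕ) (d≡ : suc d ≡ s * 2) (leveled : Leveled G d)
               (c : Fin n → Fin s) (μ ν b : ℕ) (F : List (Fin n)) where
  open Graph G
  open LeveledCliques G d leveled
  open Colouring G c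
  open ColourSums G c
  open CliqueCount G using (degree)

  Typical : Fin n → Set
  Typical v = miss v ≤ μ

  typical? : Decidable Typical
  typical? v = miss v ≤? μ

  -- Here `face j ++ T` has at most `suc d + (4 + suc d)` vertices, as `T` will consist of up to
  -- four prescribed vertices and a clique; `b` is for the atypical vertices.
  bad-bound : ℕ
  bad-bound = (suc d + (4 + suc d)) * μ + b

  outer-bound : ℕ
  outer-bound = bad-bound + suc d * ν

  module _ (clF : Clique F) (typF : All Typical F) (twice : ∀ j → occurrences j F ≡ 2)
           (few : count (¬? ∘ typical?) ≤ b) (sparse : ∀ w → inner w ≤ ν) (2ν≤μ : 2 * ν ≤ μ)
           (large : ∀ j → bad-bound + outer-bound < size j) where

    length-F : length F ≡ suc d
    length-F = trans (sym (∑-occurrences F)) (trans (sum-cong twice) (trans (sum-const s 2) (sym d≡)))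

    face : Fin s → List (Fin n)
    face j = others j F

    -- Omitting both vertices of a colour leaves codimension two, so the link of `face j` is a
    -- 2-regular graph.
    length-face : ∀ j → suc (length (face j)) ≡ d
    length-face j = suc-injective (trans (cong (_+ length (face j)) (sym (twice j))) (trans (length-filter-split (coloured? j) F) length-F))

    face≤ : ∀ j → length (face j) ≤ suc d
    face≤ j = ≤-trans (n≤1+n _) (≤-trans (≤-reflexive (length-face j)) (n≤1+n d))

    cl-face : ∀ j → Clique (face j)
    cl-face j = AllPairs.filter⁺ (¬? ∘ coloured? j) clF

    occurs : ∀ i (l : List (Fin n)) → 0 < occurrences i l → ∃[ y ] y ∈ l × c y ≡ i
    occurs i (x ∷ l) pos with c x Fin.≟ i
    ... | yes eq = x , here refl , eq
    ... | no  _  = let (y , y∈ , eq) = occurs i l pos in y , there y∈ , eq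

    Core : Fin s → List (Fin n) → Fin n → Set
    Core j T v = c v ≡ j × Linked (face j ++ T) v × Typical v

    core? : ∀ j T → Decidable (Core j T)
    core? j T v = coloured? j v ×-dec (linked? (face j ++ T) v ×-dec typical? v)

    Outer : Fin s → List (Fin n) → Fin n → Set
    Outer j T v = Linked (face j) v × ¬ Core j T v

    outer? : ∀ j T → Decidable (Outer j T)
    outer? j T v = linked? (face j) v ×-dec ¬? (core? j T v)

    Bad : Fin s → List (Fin n) → Fin n → Set
    Bad j T v = Any (λ y → Missing y v) (face j ++ T) ⊎ ¬ Typical v

    missed? : ∀ j T → Decidable (λ v → Any (λ y → Missing y v) (face j ++ T))
    missed? j T v = Any.any? (λ y → missing? y v) (face j ++ T)

    bad? : ∀ j T → Decidable (Bad j T)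
    bad? j T v = missed? j T v ⊎-dec ¬? (typical? v)

    Foreign : Fin s → Fin n → Set
    Foreign j v = Any (λ y → c v ≡ c y × Adj G y v) (face j)

    foreign? : ∀ j → Decidable (Foreign j)
    foreign? j v = Any.any? (λ y → neighbour? (c y) y v) (face j)

    Admissible : Fin s → List (Fin n) → Set
    Admissible j T = All (λ y → Typical y × c y ≢ j) T

    module Core-edges (j : Fin s) (T : List (Fin n)) (short : length T ≤ 4 + suc d) (adm : Admissible j T) where

      admissible : Admissible j (face j ++ T)
      admissible = All.++⁺ (All.zip (All.filter⁺ (¬? ∘ coloured? j) typF , All.all-filter (¬? ∘ coloured? j) F)) adm

      count-bad : count (bad? j T) ≤ bad-bound
      count-bad = ≤-trans (count-cover (bad? j T) (missed? j T) (¬? ∘ typical?) id)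
        (+-mono-≤ (≤-trans (count-Any missing? (All.map proj₁ admissible))
          (*-monoˡ-≤ μ (≤-trans (≤-reflexive (length-++ (face j))) (+-mono-≤ (face≤ j) short)))) few)

      ¬core⇒bad : ∀ {v} → c v ≡ j → ¬ Core j T v → Bad j T v
      ¬core⇒bad {v} cv ¬core = decide (linked? (face j ++ T) v) (typical? v)
        where
        decide : Dec (Linked (face j ++ T) v) → Dec (Typical v) → Bad j T v
        decide (yes linked) (yes typ) = ⊥-elim (¬core (cv , linked , typ))
        decide _            (no ¬typ) = inj₂ ¬typ
        decide (no ¬linked) (yes _)   = inj₁ (collect (All.¬All⇒Any¬ (adj? v) _ ¬linked) admissible)
          where
          collect : ∀ {l} → Any (λ y → ¬ Adj G v y) l → Admissible j l → Any (λ y → Missing y v) l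
          collect (here ¬a)   ((_ , ≢j) ∷ _) = here ((λ eq → ≢j (trans (sym eq) cv)) , ¬a ∘ Adj-sym)
          collect (there any) (_ ∷ adm)      = there (collect any adm)

      size≤ : size j ≤ bad-bound + count (core? j T)
      size≤ = ≤-trans (count-cover (coloured? j) (bad? j T) (core? j T) λ {v} cv → decide cv (core? j T v)) (+-monoˡ-≤ _ count-bad)
        where
        decide : ∀ {v} → c v ≡ j → Dec (Core j T v) → Bad j T v ⊎ Core j T v
        decide cv (yes core) = inj₂ core
        decide cv (no ¬core) = inj₁ (¬core⇒bad cv ¬core)

      -- A vertex of the link with a colour other than `j` is adjacent to a face vertex of its own
      -- colour, and `sparse` permits few such vertices. Those of colour `j` outside the core are
      -- bad.
      count-outer : count (outer? j T) ≤ outer-bound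
      count-outer = ≤-trans (count-cover (outer? j T) (bad? j T) (foreign? j) λ {v} → decide v (coloured? j v))
        (+-mono-≤ count-bad (≤-trans (count-Any (λ y → neighbour? (c y) y) (All.universal sparse (face j))) (*-monoˡ-≤ ν (face≤ j))))
        where
        decide : ∀ v → Dec (c v ≡ j) → Outer j T v → Bad j T v ⊎ Foreign j v
        decide v (yes cv) (_ , ¬core)  = inj₁ (¬core⇒bad cv ¬core)
        decide v (no ¬cv) (linked , _) = inj₂ (foreign (occurs (c v) F (≤-trans (s≤s z≤n) (≤-reflexive (sym (twice (c v)))))))
          where
          foreign : ∃[ y ] y ∈ F × c y ≡ c v → Foreign j v
          foreign (y , y∈ , eq) = lose y∈face (sym eq , Adj-sym (All.lookup linked y∈face))
            where
            y∈face : y ∈ face j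
            y∈face = ∈-filter⁺ (¬? ∘ coloured? j) y∈ λ cy → ¬cv (trans (sym eq) cy)

      linked-face : ∀ {v} → Core j T v → Linked (face j) v
      linked-face (_ , linked , _) = All.++⁻ˡ (face j) linked

      -- The link of a codimension-two face is 2-regular, so by double counting an edgeless core
      -- could not outnumber its complement in that link.
      edge : ∃[ u ] ∃[ v ] Core j T u × Core j T v × Adj G u v
      edge = decide (Fin.any? λ u → Fin.any? λ v → core? j T u ×-dec (core? j T v ×-dec adj? u v))
        where
        Edge = ∃[ u ] ∃[ v ] Core j T u × Core j T v × Adj G u v
        decide : Dec Edge → Edge
        decide (yes found) = found
        decide (no none)   = ⊥-elim (<⇒≱ (large j) (≤-trans size≤ (+-monoʳ-≤ bad-bound
          (≤-trans (*-cancelʳ-≤ _ _ 2 doubled) count-outer))))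
          where
          cross? : ∀ u → Decidable (λ v → Core j T u × Linked (u ∷ face j) v)
          cross? u v = core? j T u ×-dec linked? (u ∷ face j) v
          two-linked : ∀ {u} → Linked (face j) u → count (linked? (u ∷ face j)) ≡ 2
          two-linked linked = count-linked (linked ∷ cl-face j) (length-face j)
          doubled : count (core? j T) * 2 ≤ count (outer? j T) * 2
          doubled = double-count (core? j T) (outer? j T) cross? 2
            (λ u core → ≤-trans (≤-reflexive (sym (two-linked (linked-face core)))) (count-mono (linked? (u ∷ face j)) (cross? u) (core ,_)))
            (λ v (linked , _) → ≤-trans (count-mono (λ u → cross? u v) (linked? (v ∷ face j)) λ { (core , a ∷ _) → Adj-sym a ∷ linked-face core })
              (≤-reflexive (two-linked linked)))
            λ { u v (core , a ∷ linked) → linked , λ core′ → none (u , v , core , core′ , Adj-sym a) }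

    module _ (W : List (Fin n)) (i : Fin s) (short : length W ≤ 4) (typW : All Typical W) (colW : All (λ w → c w ≡ i) W) where

      Transversal : List (Fin s) → Set
      Transversal js = ∃[ σ ] Clique σ × All (λ x → Typical x × Linked W x × c x ∈ js) σ × length σ ≡ length js * 2

      -- Takes one edge per colour, from the core relative to `W` and the edges already chosen, so
      -- that new vertices are joined to all of these.
      transversal : ∀ js → AllPairs _≢_ js → All (_≢ i) js → Transversal js
      transversal []       []            []          = [] , [] , [] , refl
      transversal (j ∷ js) (j≢ ∷ unique) (j≢i ∷ js≢i) = add (transversal js unique js≢i)
        where
        add : Transversal js → Transversal (j ∷ js)
        add (σ , cl , all , len) = attach (Core-edges.edge j (W ++ σ)
              (≤-trans (≤-reflexive (length-++ W)) (+-mono-≤ short (length≤ cl)))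
              (All.++⁺ (All.zipWith (λ (typ , cw) → typ , λ cj → j≢i (trans (sym cj) cw)) (typW , colW))
                       (All.map (λ (typ , _ , c∈) → typ , λ cj → All.lookup j≢ c∈ (sym cj)) all)))
          where
          linked-W : ∀ {v} → Core j (W ++ σ) v → Linked W v
          linked-W (_ , linked , _) = All.++⁻ˡ W (All.++⁻ʳ (face j) linked)
          linked-σ : ∀ {v} → Core j (W ++ σ) v → Linked σ v
          linked-σ (_ , linked , _) = All.++⁻ʳ W (All.++⁻ʳ (face j) linked)
          attach : ∃[ u ] ∃[ v ] Core j (W ++ σ) u × Core j (W ++ σ) v × Adj G u v → Transversal (j ∷ js)
          attach (u , v , cu , cv , a) = u ∷ v ∷ σ , (a ∷ linked-σ cu) ∷ linked-σ cv ∷ cl ,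
            (proj₂ (proj₂ cu) , linked-W cu , here (proj₁ cu)) ∷ (proj₂ (proj₂ cv) , linked-W cv , here (proj₁ cv)) ∷
              All.map (λ (typ , linked , c∈) → typ , linked , there c∈) all ,
            cong (2 +_) len

    typical-neighbour? : ∀ w → Decidable (λ v → (c v ≡ c w × Adj G w v) × Typical v)
    typical-neighbour? w v = neighbour? (c w) w v ×-dec typical? v

    other-colours : Fin s → List (Fin s)
    other-colours i = filter (¬? ∘ (i Fin.≟_)) (allFin s)

    length-other-colours : ∀ i → suc (length (other-colours i)) ≡ s
    length-other-colours i = trans (cong (_+ length (other-colours i)) (sym (trans (length-filter-allFin (i Fin.≟_)) (trans (count≡∑ (i Fin.≟_)) (∑-point-1 i)))))
      (trans (length-filter-split (i Fin.≟_) (allFin s)) (length-tabulate id))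

    -- Suppose there were three such neighbours. A transversal `σ` of the other colours joined to
    -- `w` and to all three makes `w ∷ σ` a clique on `d` vertices, whose link has two vertices but
    -- contains the three.
    typical-degree : ∀ w → Typical w → count (typical-neighbour? w) ≤ 2
    typical-degree w typw = ≮⇒≥ λ three → refute (extract 3 (typical-neighbour? w) three)
      where
      refute : ¬ (∃[ l ] AllPairs _≢_ l × length l ≡ 3 × All (λ v → (c v ≡ c w × Adj G w v) × Typical v) l)
      refute (l , unique , len , all) = contradict (transversal (w ∷ l) (c w) (s≤s (≤-reflexive len)) (typw ∷ All.map proj₂ all)
          (refl ∷ All.map (proj₁ ∘ proj₁) all) (other-colours (c w)) (AllPairs.filter⁺ (¬? ∘ (c w Fin.≟_)) (allFin-unique s))
          (All.map (λ ≢ eq → ≢ (sym eq)) (All.all-filter (¬? ∘ (c w Fin.≟_)) (allFin s))))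
        where
        contradict : ¬ Transversal (w ∷ l) (c w) (s≤s (≤-reflexive len)) (typw ∷ All.map proj₂ all) (refl ∷ All.map (proj₁ ∘ proj₁) all) (other-colours (c w))
        contradict (σ , cl , linked , lenσ) = <⇒≱ (s≤s (≤-reflexive count2)) (≤-trans (≤-reflexive (sym len)) (unique-length≤count (linked? (w ∷ σ)) unique l-linked))
          where
          σ-w : ∀ {x} → x ∈ w ∷ l → Linked σ x
          σ-w x∈ = All.map (λ (_ , link , _) → Adj-sym (All.lookup link x∈)) linked
          count2 : count (linked? (w ∷ σ)) ≡ 2
          count2 = count-linked (σ-w (here refl) ∷ cl) (suc-injective (trans (cong (2 +_) lenσ) (trans (cong (_* 2) (length-other-colours (c w))) (sym d≡))))
          l-linked : All (Linked (w ∷ σ)) l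
          l-linked = All.tabulate λ x∈ → Adj-sym (proj₂ (proj₁ (All.lookup all x∈))) ∷ σ-w (there x∈)

    atypical-neighbour? : ∀ w → Decidable (λ v → (c v ≡ c w × Adj G w v) × ¬ Typical v)
    atypical-neighbour? w v = neighbour? (c w) w v ×-dec ¬? (typical? v)

    excess : Fin n → ℕ
    excess v = ⟦ ¬? (typical? v) ⟧ * inner v

    inner≤ : ∀ v → inner v ≤ 2 + count (atypical-neighbour? v) + excess v
    inner≤ v = decide (typical? v)
      where
      decide : Dec (Typical v) → inner v ≤ 2 + count (atypical-neighbour? v) + excess v
      decide (yes typ) = ≤-trans (≤-trans (count-cover (neighbour? (c v) v) (typical-neighbour? v) (atypical-neighbour? v)
          λ {u} nbr → split nbr (typical? u)) (+-monoˡ-≤ _ (typical-degree v typ))) (m≤m+n _ (excess v))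
        where
        split : ∀ {u} → c u ≡ c v × Adj G v u → Dec (Typical u) → ((c u ≡ c v × Adj G v u) × Typical u) ⊎ ((c u ≡ c v × Adj G v u) × ¬ Typical u)
        split nbr (yes t) = inj₁ (nbr , t)
        split nbr (no ¬t) = inj₂ (nbr , ¬t)
      decide (no ¬typ) = ≤-trans (≤-reflexive (sym (trans (cong (_* inner v) (⟦⟧-yes (¬? (typical? v)) ¬typ)) (*-identityˡ (inner v)))))
        (m≤n+m (excess v) _)

    -- A monochromatic edge from `v` to an atypical `u` is recorded at its other end by `excess u`.
    ∑-atypical-neighbours : ∑[ v < n ] count (atypical-neighbour? v) ≤ sum excess
    ∑-atypical-neighbours = begin
      ∑[ v < n ] count (atypical-neighbour? v)                 ≡⟨ sum-cong (λ v → count≡∑ (atypical-neighbour? v)) ⟩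
      ∑[ v < n ] ∑[ u < n ] ⟦ atypical-neighbour? v u ⟧        ≡⟨ sum-swap (λ v u → ⟦ atypical-neighbour? v u ⟧) ⟩
      ∑[ u < n ] ∑[ v < n ] ⟦ atypical-neighbour? v u ⟧        ≤⟨ sum-mono (λ u → sum-mono λ v → pointwise u v) ⟩
      ∑[ u < n ] ∑[ v < n ] (⟦ ¬? (typical? u) ⟧ * ⟦ neighbour? (c u) u v ⟧)
        ≡⟨ sum-cong (λ u → trans (sum-*ˡ ⟦ ¬? (typical? u) ⟧ _) (cong (⟦ ¬? (typical? u) ⟧ *_) (sym (count≡∑ (neighbour? (c u) u))))) ⟩
      sum excess ∎
      where
      open ≤-Reasoning
      pointwise : ∀ u v → ⟦ atypical-neighbour? v u ⟧ ≤ ⟦ ¬? (typical? u) ⟧ * ⟦ neighbour? (c u) u v ⟧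
      pointwise u v = ⟦⟧≤ (atypical-neighbour? v u) λ ((eq , a) , ¬t) →
        *-mono-≤ (1≤⟦⟧ (¬? (typical? u)) ¬t) (1≤⟦⟧ (neighbour? (c u) u v) (sym eq , Adj-sym a))

    -- An atypical vertex misses more than `μ` vertices, and `μ` is at least twice the bound `ν` on
    -- its neighbours of its own colour.
    2*excess≤miss : ∀ v → 2 * excess v ≤ miss v
    2*excess≤miss v = ≤-trans (≤-reflexive (rearrange ⟦ ¬? (typical? v) ⟧ (inner v)))
      (⟦⟧*≤ (¬? (typical? v)) λ ¬typ → ≤-trans (*-monoʳ-≤ 2 (sparse v)) (≤-trans 2ν≤μ (<⇒≤ (≰⇒> ¬typ))))
      where
      rearrange : ∀ a x → 2 * (a * x) ≡ a * (2 * x)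
      rearrange = RS.solve-∀

    -- Inserts `inner≤` into `balance`. The excess arises twice, from the atypical vertices
    -- themselves and from their neighbours, and `sum miss` absorbs both copies.
    degree-sum : sum degree + ∑[ v < n ] size (c v) ≤ n * n + 2 * n
    degree-sum = ≤-cancel (sum miss) (begin
      sum degree + sum miss + ∑[ v < n ] size (c v)
        ≡⟨ balance ⟩
      n * n + sum inner
        ≤⟨ +-monoʳ-≤ (n * n) (sum-mono inner≤) ⟩
      n * n + ∑[ v < n ] (2 + count (atypical-neighbour? v) + excess v)
        ≡⟨ cong (n * n +_) (trans (sum-+ _ _) (cong (_+ sum excess) (trans (sum-+ _ _) (cong (_+ ∑[ v < n ] count (atypical-neighbour? v)) (trans (sum-const n 2) (*-comm n 2)))))) ⟩
      n * n + (2 * n + ∑[ v < n ] count (atypical-neighbour? v) + sum excess)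
        ≤⟨ +-monoʳ-≤ (n * n) (+-monoˡ-≤ (sum excess) (+-monoʳ-≤ (2 * n) ∑-atypical-neighbours)) ⟩
      n * n + (2 * n + sum excess + sum excess)
        ≡⟨ double (n * n) n (sum excess) ⟩
      n * n + 2 * n + 2 * sum excess
        ≤⟨ +-monoʳ-≤ (n * n + 2 * n) (≤-trans (≤-reflexive (sym (sum-*ˡ 2 excess))) (sum-mono 2*excess≤miss)) ⟩
      n * n + 2 * n + sum miss ∎) (swap (sum degree) (sum miss) (∑[ v < n ] size (c v))) refl
      where
      open ≤-Reasoning
      double : ∀ m n e → m + (2 * n + e + e) ≡ m + 2 * n + 2 * e
      double = RS.solve-∀
      swap : ∀ a b c → a + b + c ≡ a + c + b
      swap = RS.solve-∀

-- Choice of the constants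

-- Serves to show that a clique with at least two vertices of every colour has exactly two of each,
-- its size being at most `s * 2`.
sum-tight : ∀ {s} a (f : Fin s → ℕ) → (∀ j → a ≤ f j) → sum f ≤ s * a → ∀ j → f j ≡ a
sum-tight {suc s} a f a≤ total = at
  where
  rest≥ : s * a ≤ sum (f ∘ suc)
  rest≥ = ≤-trans (≤-reflexive (sym (sum-const s a))) (sum-mono (a≤ ∘ suc))
  total′ : f zero + sum (f ∘ suc) ≤ a + s * a
  total′ = ≤-trans (≤-reflexive (sym (sum-suc f))) total
  at : ∀ j → f j ≡ a
  at zero    = ≤-antisym (+-cancelʳ-≤ (s * a) _ _ (≤-trans (+-monoʳ-≤ (f zero) rest≥) total′)) (a≤ zero)
  at (suc j) = sum-tight a (f ∘ suc) (a≤ ∘ suc) (+-cancelˡ-≤ a _ _ (≤-trans (+-monoˡ-≤ _ (a≤ zero)) total′)) j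

-- In units of ε: bad-bound and outer-bound of the recoloured classes, plus the at most b ≤ ε recoloured vertices.
capacity : ℕ → ℕ
capacity D = suc (2 * ((D + (4 + D)) * (2 * (2 + D)) + 1) + D * (2 + D))

-- Recolouring by sparse classes

module Recolour {n s : ℕ} (G : Graph n) (d : ℕ) (d≡ : suc d ≡ s * 2) (leveled : Leveled G d)
                (c : Fin n → Fin s) (ε b : ℕ) where
  open Graph G
  open LeveledCliques G d leveled
  open Colouring G c
  open Saturate G d d≡ leveled c ε b
  open CliqueCount G using (degree)

  private
    D = suc d

  module _ (few : count (¬? ∘ typical?) ≤ b) (κ≤ε : b + 2 * suc b ^ D ≤ ε) (large : ∀ j → capacity D * ε < size j) where

    b≤ε : b ≤ ε
    b≤ε = ≤-trans (m≤m+n b _) κ≤ε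

    bound≤ : bound ≤ (1 + D) * ε
    bound≤ = ≤-trans (+-monoʳ-≤ (D * ε) κ≤ε) (≤-reflexive (+-comm (D * ε) ε))

    2+D≤capacity : 2 + D ≤ capacity D
    2+D≤capacity = ≤-trans (m≤m+n (2 + D) (d * (2 + D))) (≤-trans (m≤n+m (D * (2 + D)) (2 * ((D + (4 + D)) * (2 * (2 + D)) + 1))) (n≤1+n _))

    bound+ε<size : ∀ j → bound + ε < size j
    bound+ε<size j = ≤-<-trans (≤-trans (+-monoˡ-≤ ε bound≤) (≤-trans (≤-reflexive (+-comm _ ε)) (*-monoˡ-≤ ε 2+D≤capacity))) (large j)

    -- If `w` had more than `bound` neighbours in every class, saturation inside its link would give
    -- `s * 2` vertices, and adding `w` a clique larger than a facet.
    poor-colour : ∀ w → ∃[ j ] degreeTo j w ≤ bound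
    poor-colour w = decide (Fin.any? λ j → degreeTo j w ≤? bound)
      where
      decide : Dec (∃[ j ] degreeTo j w ≤ bound) → ∃[ j ] degreeTo j w ≤ bound
      decide (yes found) = found
      decide (no none)   = ⊥-elim (overfull (saturated few (w ∷ []) rich ([] ∷ [])))
        where
        rich : ∀ j → bound < count (λ v → coloured? j v ×-dec linked? (w ∷ []) v)
        rich j = <-≤-trans (≰⇒> λ le → none (j , le))
          (count-mono (neighbour? j w) (λ v → coloured? j v ×-dec linked? (w ∷ []) v) λ (eq , a) → eq , Adj-sym a ∷ [])
        overfull : ¬ (∃[ σ ] All Typical σ × Clique (σ ++ w ∷ []) × (∀ j → 2 ≤ occurrences j σ))
        overfull (σ , _ , cl , twice) = <⇒≱ (≤-reflexive (trans (+-comm 1 (length σ)) (sym (length-++ σ))))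
          (≤-trans (length≤ cl) (≤-trans (≤-reflexive d≡) (long few (w ∷ []) rich σ twice)))

    opaque
      c′ : Fin n → Fin s
      c′ w = proj₁ (poor-colour w)

      c′-poor : ∀ w → degreeTo (c′ w) w ≤ bound
      c′-poor w = proj₂ (poor-colour w)

    -- If the colour changed, the whole new class would consist of neighbours of `v`, at most
    -- `bound`, and vertices missing at `v`, at most `ε`; the class is larger than that.
    c′≡c : ∀ {v} → Typical v → c′ v ≡ c v
    c′≡c {v} typ = decidable-stable (c′ v Fin.≟ c v) λ differ → <⇒≱ (bound+ε<size (c′ v))
      (≤-trans (count-cover (coloured? (c′ v)) (neighbour? (c′ v) v) (missing? v) (λ {u} eq → decide differ eq (adj? v u)))
        (+-mono-≤ (c′-poor v) typ))
      where
      decide : ∀ {u} → c′ v ≢ c v → c u ≡ c′ v → Dec (Adj G v u) → (c u ≡ c′ v × Adj G v u) ⊎ Missing v u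
      decide differ eq (yes a) = inj₁ (eq , a)
      decide differ eq (no ¬a) = inj₂ ((λ eq′ → differ (trans (sym eq) eq′)) , ¬a)

    module C′ = Colouring G c′
    module S′ = ColourSums G c′

    -- Transfers counts between the two colourings, which agree off the at most `b` atypical
    -- vertices.
    count-agree : {P Q : Fin n → Set} (P? : Decidable P) (Q? : Decidable Q) →
                  (∀ {u} → Typical u → P u → Q u) → count P? ≤ count Q? + b
    count-agree {P} {Q} P? Q? P⇒Q = ≤-trans (count-cover P? Q? (¬? ∘ typical?) λ {u} p → decide p (typical? u)) (+-monoʳ-≤ (count Q?) few)
      where
      decide : ∀ {u} → P u → Dec (Typical u) → Q u ⊎ ¬ Typical u
      decide p (yes typ) = inj₁ (P⇒Q typ p)
      decide p (no ¬typ) = inj₂ ¬typ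

    -- `ν` covers `bound`, at most `(1 + D) * ε`, and the at most `b ≤ ε` atypical vertices. The
    -- doubling in `μ` pays for the two copies of the excess in `degree-sum`.
    ν μ : ℕ
    ν = (2 + D) * ε
    μ = 2 * ν

    miss′≤ : ∀ {v} → Typical v → C′.miss v ≤ μ
    miss′≤ {v} typ = begin
      C′.miss v     ≤⟨ count-agree (C′.missing? v) (missing? v) (λ typu (differ , ¬a) →
                         (λ eq → differ (trans (c′≡c typu) (trans eq (sym (c′≡c typ))))) , ¬a) ⟩
      miss v + b    ≤⟨ +-mono-≤ typ b≤ε ⟩
      ε + ε         ≤⟨ +-mono-≤ (m≤m+n ε ((1 + D) * ε)) (≤-trans (m≤m+n ε ((1 + D) * ε)) (m≤m+n ν 0)) ⟩
      μ             ∎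
      where open ≤-Reasoning

    sparse′ : ∀ w → S′.inner w ≤ ν
    sparse′ w = begin
      S′.inner w                   ≤⟨ count-agree (C′.neighbour? (c′ w) w) (neighbour? (c′ w) w) (λ typ (eq , a) → trans (sym (c′≡c typ)) eq , a) ⟩
      degreeTo (c′ w) w + b        ≤⟨ +-mono-≤ (≤-trans (c′-poor w) bound≤) b≤ε ⟩
      (1 + D) * ε + ε              ≡⟨ +-comm _ ε ⟩
      ν                            ∎
      where open ≤-Reasoning

    size≤size′ : ∀ j → size j ≤ C′.size j + b
    size≤size′ j = count-agree (coloured? j) (C′.coloured? j) λ typ eq → trans (c′≡c typ) eq

    occurrences′ : ∀ j {l} → All Typical l → C′.occurrences j l ≡ occurrences j l
    occurrences′ j []             = refl
    occurrences′ j {x ∷ l} (typ ∷ typs) with c′ x | c′≡c typ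
    ... | .(c x) | refl with c x Fin.≟ j
    ...   | yes _ = cong suc (occurrences′ j typs)
    ...   | no  _ = occurrences′ j typs

    recoloured-degree-sum : sum degree + ∑[ v < n ] C′.size (c′ v) ≤ n * n + 2 * n
    recoloured-degree-sum = conclude (saturated few [] rich [])
      where
      rich : ∀ j → bound < count (λ v → coloured? j v ×-dec linked? [] v)
      rich j = ≤-trans (≤-<-trans (m≤m+n bound ε) (bound+ε<size j)) (count-mono (coloured? j) (λ v → coloured? j v ×-dec linked? [] v) (_, []))
      open Endgame G d d≡ leveled c′ μ ν b using (bad-bound; outer-bound; degree-sum)
      large′ : ∀ j → bad-bound [] + outer-bound [] < C′.size j
      large′ j = +-cancelʳ-< b _ _ (<-≤-trans (≤-<-trans fits (large j)) (size≤size′ j))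
        where
        open ≤-Reasoning
        fits : bad-bound [] + outer-bound [] + b ≤ capacity D * ε
        fits = begin
          Z * μ + b + (Z * μ + b + D * ν) + b  ≤⟨ +-mono-≤ (+-mono-≤ (+-monoʳ-≤ (Z * μ) b≤ε) (+-monoˡ-≤ (D * ν) (+-monoʳ-≤ (Z * μ) b≤ε))) b≤ε ⟩
          Z * μ + ε + (Z * μ + ε + D * ν) + ε  ≡⟨ collect Z (2 + D) D ε ⟩
          capacity D * ε                       ∎
          where
          Z = D + (4 + D)
          collect : ∀ z w D ε → z * (2 * (w * ε)) + ε + (z * (2 * (w * ε)) + ε + D * (w * ε)) + ε ≡ suc (2 * (z * (2 * w) + 1) + D * w) * ε
          collect = RS.solve-∀
      conclude : ∃[ F ] All Typical F × Clique (F ++ []) × (∀ j → 2 ≤ occurrences j F) → sum degree + ∑[ v < n ] C′.size (c′ v) ≤ n * n + 2 * n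
      conclude (F , typF , cl , twice) = degree-sum F clF (All.map miss′≤ typF)
          (λ j → trans (occurrences′ j typF) (sum-tight 2 (λ j → occurrences j F) twice
            (≤-trans (≤-reflexive (∑-occurrences F)) (≤-trans (length≤ clF) (≤-reflexive d≡))) j))
          (≤-trans (count-mono (λ v → ¬? (C′.miss v ≤? μ)) (¬? ∘ typical?) λ ¬typ typ → ¬typ (miss′≤ typ)) few)
          sparse′ ≤-refl large′
        where
        clF : Clique F
        clF = subst Clique (++-identityʳ F) cl

-- Explicit constants and the final estimate

module Extremal (m p : ℕ) where
  -- `K` comes from `sparse-colouring`; `N` makes `capacity D * ε` at most `n / (2 * s)` for
  -- `ε = n / N`; `b` will bound the number of atypical vertices, and `κ` is the part of `bound`
  -- free of `ε`. The summands of `n₀` ensure `κ ≤ ε` and the gap required by `size-lower`.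
  s d D K N b κ n₀ : ℕ
  s = suc m
  d = 2 * s ∸ 1
  D = suc d
  K = 2 * (2 * s * suc s ^ suc s * p * s ^ s)
  N = 2 * s * capacity D
  b = K * N
  κ = b + 2 * suc b ^ D
  n₀ = suc (N * suc κ + 4 * s * (s * K))

  module _ {n : ℕ} (G : Graph n) (n₀≤n : n₀ ≤ n) (leveled : Leveled G d) where
    open CliqueCount G using (degree)

    ε : ℕ
    ε = n / N

    n<[1+ε]N : n < suc ε * N
    n<[1+ε]N = ≤-<-trans (≤-reflexive (m≡m%n+[m/n]*n n N)) (+-monoˡ-< (ε * N) (m%n<n n N))

    κ≤ε : κ ≤ ε
    κ≤ε = s≤s⁻¹ (<⇒≤ (*-cancelˡ-< N _ _ (begin-strict
      N * suc κ    ≤⟨ ≤-trans (m≤m+n _ _) (<⇒≤ n₀≤n) ⟩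
      n            <⟨ n<[1+ε]N ⟩
      suc ε * N    ≡⟨ *-comm (suc ε) N ⟩
      N * suc ε    ∎)))
      where open ≤-Reasoning

    large-n : 4 * s * (s * K) < n
    large-n = ≤-trans (s≤s (m≤n+m _ (N * suc κ))) n₀≤n

    module _ (dense : m * n * n ≤ s * sum degree) (c : Fin n → Fin s)
             (sparse : SparseColouring.monochromatic G m c ≤ K * n) where
      open Graph G
      open Colouring G c
      open ColourSums G c
      open ≤-Reasoning

      S₂ : ℕ
      S₂ = ∑[ v < n ] size (c v)

      ∑-inner≤ : sum inner ≤ K * n
      ∑-inner≤ = ≤-trans (sum-mono λ u → ≤-trans (≤-reflexive (count≡∑ (neighbour? (c u) u))) (sum-mono λ v →
          ⟦⟧≤ (neighbour? (c u) u v) λ (eq , a) → *-mono-≤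
            (≤-trans (1≤⟦⟧ (c u Fin.≟ c v) (sym eq)) (≤-reflexive (⟦⟧≡𝟙 (c u Fin.≟ c v)))) (≤-reflexive (cong 𝟙 (sym a))))) sparse

      squares : n * n ≤ s * S₂
      squares = size-square-lower (s≤s z≤n)

      -- Density and `squares` together give `s * (n * n) ≤ s * (sum degree + S₂)`, so `balance`
      -- leaves at most `sum inner` for the missing pairs.
      ∑-miss≤ : sum miss ≤ K * n
      ∑-miss≤ = ≤-trans (*-cancelˡ-≤ s (≤-cancel (m * n * n + n * n) (begin
        m * n * n + n * n + s * sum miss                  ≤⟨ +-monoˡ-≤ (s * sum miss) (+-mono-≤ dense squares) ⟩
        s * sum degree + s * S₂ + s * sum miss             ≡⟨ factor s (sum degree) S₂ (sum miss) ⟩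
        s * (sum degree + sum miss + S₂)                   ≡⟨ cong (s *_) balance ⟩
        s * (n * n + sum inner)                           ∎) (+-comm _ (s * sum miss)) (split m n (sum inner)))) ∑-inner≤
        where
        factor : ∀ s x y z → s * x + s * y + s * z ≡ s * (x + z + y)
        factor = RS.solve-∀
        split : ∀ m n i → suc m * (n * n + i) ≡ suc m * i + (m * n * n + n * n)
        split = RS.solve-∀

      squares-upper : s * S₂ ≤ n * n + s * (K * n)
      squares-upper = ≤-cancel (m * n * n) (begin
        m * n * n + s * S₂                                 ≤⟨ +-monoˡ-≤ (s * S₂) (≤-trans dense (*-monoʳ-≤ s (m≤m+n (sum degree) (sum miss)))) ⟩
        s * (sum degree + sum miss) + s * S₂               ≡⟨ trans (sym (*-distribˡ-+ s _ S₂)) (cong (s *_) balance) ⟩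
        s * (n * n + sum inner)                           ≤⟨ *-monoʳ-≤ s (+-monoʳ-≤ (n * n) ∑-inner≤) ⟩
        s * (n * n + K * n)                               ∎) (+-comm (m * n * n) (s * S₂)) (split m n (K * n))
        where
        split : ∀ m n i → suc m * (n * n + i) ≡ n * n + suc m * i + m * n * n
        split = RS.solve-∀

      large : ∀ j → capacity D * ε < size j
      large j = *-cancelˡ-< (2 * s) _ _ (begin-strict
        2 * s * (capacity D * ε)    ≡⟨ trans (sym (*-assoc (2 * s) (capacity D) ε)) (*-comm N ε) ⟩
        ε * N                       ≤⟨ m/n*n≤m n N ⟩
        n                           <⟨ size-lower (s * (K * n)) squares-upper gap j ⟩
        2 * s * size j              ∎)
        where
        regroup : ∀ s K n → 4 * s * (s * (K * n)) ≡ 4 * s * (s * K) * n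
        regroup = RS.solve-∀
        gap : 4 * s * (s * (K * n)) < n * n
        gap = ≤-<-trans (≤-reflexive (regroup s K n)) (*-monoˡ-< n {{>-nonZero (≤-<-trans z≤n large-n)}} large-n)

      typical? : Decidable (λ v → miss v ≤ ε)
      typical? v = miss v ≤? ε

      -- Markov's inequality: an atypical vertex misses at least `suc ε` vertices, and
      -- `n < suc ε * N` removes the dependence on `n`.
      few : count (¬? ∘ typical?) ≤ b
      few = *-cancelʳ-≤ _ _ (suc ε) (begin
        count (¬? ∘ typical?) * suc ε                     ≡⟨ trans (cong (_* suc ε) (count≡∑ (¬? ∘ typical?))) (sym (sum-*ʳ (suc ε) _)) ⟩
        ∑[ v < n ] (⟦ ¬? (typical? v) ⟧ * suc ε)          ≤⟨ sum-mono (λ v → ⟦⟧*≤ (¬? (typical? v)) ≰⇒>) ⟩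
        sum miss                                          ≤⟨ ∑-miss≤ ⟩
        K * n                                             ≤⟨ *-monoʳ-≤ K (<⇒≤ n<[1+ε]N) ⟩
        K * (suc ε * N)                                   ≡⟨ trans (cong (K *_) (*-comm (suc ε) N)) (sym (*-assoc K N (suc ε))) ⟩
        b * suc ε                                         ∎)

      degrees : s * sum degree ≤ m * (n * n) + 2 * s * n
      degrees = ≤-cancel (n * n) (begin
        s * sum degree + n * n                            ≤⟨ +-monoʳ-≤ (s * sum degree) (ColourSums.size-square-lower G c″ (s≤s z≤n)) ⟩
        s * sum degree + s * S″                           ≡⟨ sym (*-distribˡ-+ s (sum degree) S″) ⟩
        s * (sum degree + S″)                             ≤⟨ *-monoʳ-≤ s (Recolour.recoloured-degree-sum G d d≡ leveled c ε b few κ≤ε large) ⟩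
        s * (n * n + 2 * n)                               ∎) refl (split m n)
        where
        d≡ : suc d ≡ s * 2
        d≡ = *-comm 2 s
        c″ = Recolour.c′ G d d≡ leveled c ε b few κ≤ε large
        S″ = ∑[ v < n ] Colouring.size G c″ (c″ v)
        split : ∀ m n → suc m * (n * n + 2 * n) ≡ m * (n * n) + 2 * suc m * n + n * n
        split = RS.solve-∀

theorem1p5 : ∀ (s : ℕ) → 1 ≤ s →
    -- the constant C > 0 is the positive rational p / q
    ∀ (p q : ℕ) → 1 ≤ p → 1 ≤ q →
    ∃[ n₀ ] ∀ (n : ℕ) (G : Graph n) → n₀ ≤ n →
      Leveled G (2 * s ∸ 1) →
      q * k (suc s) G ≤ p * n ^ s →
      2 * s * numEdges G ≤ (s ∸ 1) * (n * n) + 2 * s * n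
theorem1p5 (suc m) _ p q _ 1≤q = Extremal.n₀ m p , λ n G n₀≤n leveled few → ≮⇒≥ λ many →
  let s = suc m
      D = sum (CliqueCount.degree G)
      edges : 2 * s * numEdges G ≤ s * D
      edges = ≤-trans (≤-reflexive (trans (cong (_* numEdges G) (*-comm 2 s)) (*-assoc s 2 (numEdges G)))) (*-monoʳ-≤ s (CliqueCount.2*numEdges≤ G))
      -- Exceeding the claimed bound gives the density hypothesis once `2 * s * n` is discarded;
      -- `Extremal.degrees` then contradicts the full excess.
      dense : m * n * n ≤ s * D
      dense = ≤-trans (≤-reflexive (*-assoc m n n)) (≤-trans (m≤m+n _ (2 * s * n)) (≤-trans (<⇒≤ many) edges))
      (c , sparse) = SparseColouring.sparse-colouring G m p q 1≤q (≤-trans (s≤s z≤n) n₀≤n) dense few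
  in <⇒≱ many (≤-trans edges (Extremal.degrees m p G n₀≤n leveled dense c sparse))
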